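{- Let $F$ and $H$ be $r$-regular non-isomorphic cospectral graphs. Then for every graph $G$: (a) $G\veebar F$ and $G\veebar H$ are $\{A,Q,L\}$NICS; (b) $G\underset{=}{\vee}F$ and $G\underset{=}{\vee}H$ are $\{A,Q,L\}$NICS.
   Context: Graphs are finite, undirected and simple. $A(G)$ is the adjacency matrix, $D(G)$ the diagonal matrix of vertex degrees, $L(G)=D(G)-A(G)$ the Laplacian, $Q(G)=D(G)+A(G)$ the signless Laplacian. For $X\in\{A,L,Q\}$ the $X$-spectrum of $G$ is the multiset of eigenvalues of $X(G)$; two graphs are $X$-cospectral if they have the same $X$-spectrum. For a set $S$ of such matrix types, two graphs are $S$NICS if they are non-isomorphic and $X$-cospectral for every $X\in S$. Two regular graphs are called cospectral if they have the same adjacency spectrum (for regular graphs this is equivalent to being $L$-cospectral or $Q$-cospectral). For vertex-disjoint graphs $G_1$ (with $V(G_1)=\{u_1,\dots,u_{n}\}$) and $G_2$, the join $G_1\vee G_2$ is the disjoint union together with all edges between $V(G_1)$ and $V(G_2)$. The NS (Neighbors Splitting) join $G_1\veebar G_2$ is obtained from $G_1\vee G_2$ by adding new vertices $u_1',\dots,u_{n}'$ and joining $u_i'$ to $u_j$ if and only if $u_iu_j\in E(G_1)$. The NNS (Non Neighbors Splitting) join $G_1\underset{=}{\vee}G_2$ is obtained from $G_1\vee G_2$ by adding new vertices $u_1',\dots,u_{n}'$ and joining $u_i'$ to $u_j$ if and only if $i\ne j$ and $u_iu_j\notin E(G_1)$. -}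

module Defs where

open import Level using (Level; _⊔_) renaming (suc to lsuc)
open import Algebra.Apartness.Bundles using (HeytingField; HeytingCommutativeRing)
open import Algebra.Bundles using (CommutativeRing)
open import Algebra.Bundles.Raw using (RawRing)
import Algebra.Definitions.RawMonoid as RawMonoidDefs
import Algebra.Definitions.RawSemiring as RawSemiringDefs
open import Data.Bool.Base using (Bool; true; false; not; _∧_; if_then_else_)
open import Data.Fin.Base using (Fin; zero; suc; toℕ; splitAt)
open import Data.Fin.Properties using (_≟_)
open import Data.Fin.Subset using (∣_∣)
open import Data.List.Base using (List; []; _∷_; foldr; map)
open import Data.List.Membership.Propositional using (_∈_)
open import Data.Nat.Base using (ℕ; zero; suc; _+_)
open import Data.Product.Base using (∃; _×_)
open import Data.Sum.Base using (_⊎_; inj₁; inj₂; [_,_]′)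
open import Data.Vec.Base using (tabulate)
open import Data.Vec.Functional using (Vector; removeAt)
open import Function.Base using (const; _∘_)
open import Function.Bundles using (_↔_; Inverse)
open import Relation.Binary.PropositionalEquality.Core using (_≡_; refl)
open import Relation.Nullary.Decidable.Core using (⌊_⌋)
open import Relation.Nullary.Negation.Core using (¬_)

private
  variable
    a c ℓ ℓ₁ ℓ₂ : Level

record Graph : Set where
  field
    order  : ℕ
    adj    : Fin order → Fin order → Bool
    sym    : ∀ i j → adj i j ≡ adj j i
    irrefl : ∀ i → adj i i ≡ false

open Graph public using (order; adj)

record _≅_ (G H : Graph) : Set where
  field
    bijection : Fin (order G) ↔ Fin (order H)
    preserves : ∀ i j →
      adj H (Inverse.to bijection i) (Inverse.to bijection j) ≡ adj G i j

degree : (G : Graph) → Fin (order G) → ℕ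
degree G i = ∣ tabulate (adj G i) ∣

Regular : ℕ → Graph → Set
Regular r G = ∀ i → degree G i ≡ r

infixl 6 _∨_ _⊻_ _⩣_

_∨_ : Graph → Graph → Graph
G ∨ H = record
  { order  = order G + order H
  ; adj    = λ x y → E (splitAt (order G) x) (splitAt (order G) y)
  ; sym    = λ x y → E-sym (splitAt (order G) x) (splitAt (order G) y)
  ; irrefl = λ x → E-irrefl (splitAt (order G) x)
  }
  where
  E : (x y : Fin (order G) ⊎ Fin (order H)) → Bool
  E (inj₁ i) (inj₁ j) = adj G i j
  E (inj₁ _) (inj₂ _) = true
  E (inj₂ _) (inj₁ _) = true
  E (inj₂ i) (inj₂ j) = adj H i j

  E-sym : ∀ x y → E x y ≡ E y x
  E-sym (inj₁ i) (inj₁ j) = Graph.sym G i j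
  E-sym (inj₁ _) (inj₂ _) = refl
  E-sym (inj₂ _) (inj₁ _) = refl
  E-sym (inj₂ i) (inj₂ j) = Graph.sym H i j

  E-irrefl : ∀ x → E x x ≡ false
  E-irrefl (inj₁ i) = Graph.irrefl G i
  E-irrefl (inj₂ i) = Graph.irrefl H i

-- k new, pairwise non-adjacent vertices, the i-th of them joined to exactly
-- the old vertices x with N i x ≡ true.
addVertices : (G : Graph) (k : ℕ) → (Fin k → Fin (order G) → Bool) → Graph
addVertices G k N = record
  { order  = order G + k
  ; adj    = λ x y → E (splitAt (order G) x) (splitAt (order G) y)
  ; sym    = λ x y → E-sym (splitAt (order G) x) (splitAt (order G) y)
  ; irrefl = λ x → E-irrefl (splitAt (order G) x)
  }
  where
  E : (x y : Fin (order G) ⊎ Fin k) → Bool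
  E (inj₁ x) (inj₁ y) = adj G x y
  E (inj₁ x) (inj₂ i) = N i x
  E (inj₂ i) (inj₁ x) = N i x
  E (inj₂ _) (inj₂ _) = false

  E-sym : ∀ x y → E x y ≡ E y x
  E-sym (inj₁ x) (inj₁ y) = Graph.sym G x y
  E-sym (inj₁ _) (inj₂ _) = refl
  E-sym (inj₂ _) (inj₁ _) = refl
  E-sym (inj₂ _) (inj₂ _) = refl

  E-irrefl : ∀ x → E x x ≡ false
  E-irrefl (inj₁ x) = Graph.irrefl G x
  E-irrefl (inj₂ _) = refl

-- The NS join: u′ᵢ is joined to uⱼ iff uᵢuⱼ is an edge of G.
_⊻_ : Graph → Graph → Graph
G ⊻ H = addVertices (G ∨ H) (order G)
  λ i → [ adj G i , const false ]′ ∘ splitAt (order G)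

-- The NNS join: u′ᵢ is joined to uⱼ iff i ≢ j and uᵢuⱼ is not an edge of G.
_⩣_ : Graph → Graph → Graph
G ⩣ H = addVertices (G ∨ H) (order G)
  λ i → [ (λ j → not ⌊ i ≟ j ⌋ ∧ not (adj G i j)) , const false ]′
        ∘ splitAt (order G)

Matrix : Set a → ℕ → Set a
Matrix A n = Vector (Vector A n) n

-- Laplace expansion along the first row.
det : (R : RawRing c ℓ) → ∀ {n} → Matrix (RawRing.Carrier R) n → RawRing.Carrier R
det R {zero}  M = RawRing.1# R
det R {suc n} M =
  sum λ j → ((- 1#) ^ toℕ j * M zero j) * det R (λ i → removeAt (M (suc i)) j)
  where
  open RawRing R using (_*_; -_; 1#; +-rawMonoid; rawSemiring)
  open RawMonoidDefs +-rawMonoid using (sum)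
  open RawSemiringDefs rawSemiring using (_^_)

module Polynomial (R : RawRing c ℓ) where
  open RawRing R
    renaming (Carrier to A; _+_ to _+ᴿ_; _*_ to _*ᴿ_; -_ to -ᴿ_)

  -- Coefficients in order of increasing degree; trailing zeros are allowed.
  Poly : Set c
  Poly = List A

  coeff : Poly → ℕ → A
  coeff []      _       = 0#
  coeff (x ∷ _) zero    = x
  coeff (_ ∷ p) (suc k) = coeff p k

  _≋_ : Poly → Poly → Set ℓ
  p ≋ q = ∀ k → coeff p k ≈ coeff q k

  _+ᴾ_ : Poly → Poly → Poly
  []      +ᴾ q       = q
  (x ∷ p) +ᴾ []      = x ∷ p
  (x ∷ p) +ᴾ (y ∷ q) = (x +ᴿ y) ∷ (p +ᴾ q)

  _*ᴾ_ : Poly → Poly → Poly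
  []      *ᴾ q = []
  (x ∷ p) *ᴾ q = map (x *ᴿ_) q +ᴾ (0# ∷ (p *ᴾ q))

  polyRing : RawRing c ℓ
  polyRing = record
    { Carrier = Poly
    ; _≈_     = _≋_
    ; _+_     = _+ᴾ_
    ; _*_     = _*ᴾ_
    ; -_      = map (-ᴿ_)
    ; 0#      = []
    ; 1#      = 1# ∷ []
    }

  -- X - x
  X-_ : A → Poly
  X- x = (-ᴿ x) ∷ 1# ∷ []

  -- det (X I - M)
  charpoly : ∀ {n} → Matrix A n → Poly
  charpoly M = det polyRing λ i j →
    if ⌊ i ≟ j ⌋ then X- (M i j) else (-ᴿ (M i j)) ∷ []

  -- The eigenvalues of M, repeated according to algebraic multiplicity, are xs.
  HasSpectrum : ∀ {n} → Matrix A n → List A → Set ℓ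
  HasSpectrum M xs = charpoly M ≋ foldr (λ x p → (X- x) *ᴾ p) (1# ∷ []) xs

-- Stands in for ℂ, which the standard library does not provide.
record AlgebraicallyClosedField₀ c ℓ₁ ℓ₂ : Set (lsuc (c ⊔ ℓ₁ ⊔ ℓ₂)) where
  field
    heytingField : HeytingField c ℓ₁ ℓ₂

  open HeytingField heytingField public
    using (Carrier; _≈_; 0#; 1#; heytingCommutativeRing)
    renaming (_+_ to _+ᴷ_; _*_ to _*ᴷ_; -_ to -ᴷ_)

  commutativeRing : CommutativeRing c ℓ₁
  commutativeRing = HeytingCommutativeRing.commutativeRing heytingCommutativeRing

  rawRing : RawRing c ℓ₁
  rawRing = CommutativeRing.rawRing commutativeRing

  open RawMonoidDefs (RawRing.+-rawMonoid rawRing) public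
    using (sum) renaming (_×_ to _×ᴷ_)
  open RawSemiringDefs (RawRing.rawSemiring rawRing) public
    using (_^_)

  field
    characteristicZero : ∀ n → ¬ (suc n ×ᴷ 1# ≈ 0#)
    -- Every monic polynomial of positive degree has a root.
    algebraicallyClosed : ∀ n (a : Vector Carrier (suc n)) →
      ∃ λ x → (x ^ suc n) +ᴷ sum (λ i → a i *ᴷ (x ^ toℕ i)) ≈ 0#

data MatrixType : Set where
  A L Q : MatrixType

module _ (R : RawRing c ℓ) where
  open RawRing R using (Carrier; 0#; 1#; +-rawMonoid) renaming (_+_ to _+ᴿ_; -_ to -ᴿ_)
  open RawMonoidDefs +-rawMonoid renaming (_×_ to _×ᴿ_) using ()

  adjacencyMatrix degreeMatrix : (G : Graph) → Matrix Carrier (order G)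
  adjacencyMatrix G i j = if adj G i j then 1# else 0#
  degreeMatrix    G i j = if ⌊ i ≟ j ⌋ then degree G i ×ᴿ 1# else 0#

  matrix : MatrixType → (G : Graph) → Matrix Carrier (order G)
  matrix A G i j = adjacencyMatrix G i j
  matrix L G i j = degreeMatrix G i j +ᴿ (-ᴿ adjacencyMatrix G i j)
  matrix Q G i j = degreeMatrix G i j +ᴿ adjacencyMatrix G i j

module _ (K : AlgebraicallyClosedField₀ c ℓ₁ ℓ₂) where
  open AlgebraicallyClosedField₀ K using (Carrier; rawRing)
  open Polynomial rawRing using (HasSpectrum)

  Cospectral : MatrixType → Graph → Graph → Set (c ⊔ ℓ₁)
  Cospectral X G H = ∃ λ xs →
    HasSpectrum (matrix rawRing X G) xs × HasSpectrum (matrix rawRing X H) xs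

  NICS : List MatrixType → Graph → Graph → Set (c ⊔ ℓ₁)
  NICS S G H = ¬ (G ≅ H) × (∀ X → X ∈ S → Cospectral X G H)

{-# OPTIONS --safe #-}
module Submission where

open import Defs
open import Data.List.Base using ([]; _∷_)
open import Data.Nat.Base using (ℕ)
open import Data.Product.Base using (_×_)
open import Relation.Nullary.Negation.Core using (¬_)

open import Algebra.Bundles using (CommutativeRing)
open import Algebra.Bundles.Raw using (RawRing)
import Algebra.Definitions.RawMonoid as RawMonoidDefs
open import Algebra.Morphism.Construct.Identity using (isRingHomomorphism)
open import Algebra.Morphism.Structures using (IsRingHomomorphism)
open import Data.Bool.Base using (Bool; true; false; not; _∧_; if_then_else_)
open import Data.Bool.Properties using (not-injective)
open import Data.Fin.Base using (Fin; zero; suc; toℕ; punchIn; punchOut; splitAt; join; _↑ˡ_; _↑ʳ_)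
open import Data.Fin.Permutation using (Permutation; _⟨$⟩ʳ_; permutation; ↔⇒≡)
import Data.Fin.Permutation.Components as PC
open import Data.Fin.Permutation.Transposition.List using (TranspositionList; eval; decompose; eval-decompose)
open import Data.Fin.Properties using (_≟_; any?; suc-injective; injective⇒≤; punchOut-injective;
  punchIn-punchOut; punchInᵢ≢i; splitAt-join; join-splitAt; splitAt-↑ˡ; splitAt-↑ʳ; splitAt⁻¹-↑ˡ;
  splitAt⁻¹-↑ʳ; ↑ʳ-injective)
import Data.Fin.Subset as Subset
open import Data.List.Base using (length; map; foldr)
open import Data.Nat.Base using (zero; suc; _≤_; _<_; z≤n; s≤s)
import Data.Nat.Base as ℕ
import Data.Nat.Properties as ℕₚ
open import Data.Product.Base using (_,_; proj₁; proj₂; ∃; ∃₂)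
open import Data.Sum.Base as Sum using (_⊎_; inj₁; inj₂; [_,_]′)
open import Data.Vec.Base using (tabulate)
open import Data.Vec.Functional using (Vector; updateAt; _++_; tail) renaming (_∷_ to _◂_; [] to ⟨⟩)
open import Data.Vec.Functional.Properties using (updateAt-updates; updateAt-minimal)
open import Data.Vec.Properties using (tabulate-cong)
open import Function.Base using (_∘_; id; const; flip)
open import Function.Bundles using (Inverse; Injection; mk↔ₛ′)
open import Function.Construct.Symmetry using (↔-sym)
open import Function.Definitions using (Injective)
open import Function.Properties.Inverse using (↔⇒↣)
open import Relation.Binary.Definitions using (tri<; tri≈; tri>)
open import Relation.Binary.PropositionalEquality as ≡ using (_≡_; _≢_; module ≡-Reasoning)
open import Relation.Nullary.Decidable.Core using (yes; no; ⌊_⌋)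
open import Relation.Nullary.Negation.Core using (contradiction)

-- Cospectrality. Order the vertices of a join with F first. The block of x I - M on F is an
-- affine image of x I - A(F), its columns have a common sum β since F is regular, and each
-- other row is constant on it. Scaling the other rows by β and subtracting multiples of the
-- rows of F clears the part below the block, so a power of the monic polynomial β times the
-- characteristic polynomial is a value of that of A(F) times a factor depending on F only
-- through r and its order. Cancelling β leaves equal characteristic polynomials.
--
-- Non-isomorphism. View F and H as vertex sets of a common graph. If F ≠ H and r ≠ 0, then
-- F \ H consists of base vertices of the decomposition along H, and conversely. For the NNS
-- join this makes F and H complete. For the NS join F meets H, every base vertex of one
-- decomposition lies in the other regular graph, and following F \ H through the base
-- vertices into H gives an isomorphism F ≅ H.

-- Determinants

-- The scaling by β could not be undone for scalars, because a value of β may be zero and equality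
-- in the field is not decidable. Everything is therefore computed over the polynomial ring: there β
-- is monic of degree one and is cancelled by comparing coefficients from the top, without any test
-- for zero. For the same reason the characteristic polynomial of A(F) is evaluated at a linear
-- polynomial and not at a scalar. Equal characteristic polynomials are not yet cospectrality, which
-- asks for an explicit list of eigenvalues; algebraic closedness supplies it. For the second half
-- the obstacle is that an isomorphism of the joins need not carry F onto H, and degrees alone need
-- not tell a vertex of F from one of G. What can be used is that F is joined completely to the base
-- vertices and not at all to the copies, which rules out most displacements. The exclusions also
-- need a vertex of H to have a neighbour, hence the separate case r = 0. As the orders agree, an
-- injective edge-preserving map is enough for an isomorphism.

module Determinant {c ℓ} (R : CommutativeRing c ℓ) where
  open CommutativeRing R hiding (zero)
  open import Algebra.Properties.Ring ring
    using (-‿involutive; +-inverseʳ-unique)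
  open import Algebra.Properties.Semiring.Sum semiring
    using (sum; sum-cong-≋; ∑-distrib-+; ∑-comm; *-distribˡ-sum; sum-replicate-zero)
  open import Algebra.Definitions.RawSemiring (RawRing.rawSemiring rawRing) using (_^_)
  open import Algebra.Solver.Ring.NaturalCoefficients.Default commutativeSemiring
    using (solve; _:=_; _:+_; _:*_)
  open import Relation.Binary.Reasoning.Setoid setoid

  ∣_∣ : ∀ {n} → Matrix Carrier n → Carrier
  ∣ M ∣ = det rawRing M

  sgn : ℕ → Carrier
  sgn k = (- 1#) ^ k

  minor : ∀ {n} → Matrix Carrier (suc n) → Fin (suc n) → Fin (suc n) → Matrix Carrier n
  minor M i j k l = M (punchIn i k) (punchIn j l)

  laplace : ∀ {n} → Matrix Carrier (suc n) → Vector Carrier (suc n)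
  laplace M j = (sgn (toℕ j) * M zero j) * ∣ minor M zero j ∣

  sum-zero : ∀ {n} {f : Vector Carrier n} → (∀ i → f i ≈ 0#) → sum f ≈ 0#
  sum-zero {n} f≈0 = trans (sum-cong-≋ f≈0) (sum-replicate-zero n)

  sum-linear : ∀ {n} a b (f g : Vector Carrier n) →
    sum (λ i → a * f i + b * g i) ≈ a * sum f + b * sum g
  sum-linear a b f g = trans (∑-distrib-+ (λ i → a * f i) (λ i → b * g i))
    (+-cong (sym (*-distribˡ-sum a f)) (sym (*-distribˡ-sum b g)))

  sum-++ : ∀ m {n} (f : Vector Carrier (m ℕ.+ n)) →
    sum f ≈ sum (λ i → f (i ↑ˡ n)) + sum (λ j → f (m ↑ʳ j))
  sum-++ zero    f = sym (+-identityˡ _)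
  sum-++ (suc m) f = trans (+-congˡ (sum-++ m (tail f))) (sym (+-assoc _ _ _))

  det-cong : ∀ {n} {M N : Matrix Carrier n} → (∀ i j → M i j ≈ N i j) → ∣ M ∣ ≈ ∣ N ∣
  det-cong {zero}  M≈N = refl
  det-cong {suc n} {M} {N} M≈N = sum-cong-≋ {x = laplace M} {laplace N} λ j →
    *-cong (*-congˡ (M≈N zero j)) (det-cong λ k l → M≈N (suc k) (punchIn j l))

  -- The corner term is common to both expansions. Every other minor of the row expansion still
  -- contains the first column, so it is expanded along it by induction; exchanging the two sums
  -- regroups the terms into row expansions of the minors of the first column. The minors with two
  -- rows and two columns deleted agree by computation.
  det-column : ∀ {n} (M : Matrix Carrier (suc n)) →
    ∣ M ∣ ≈ sum λ i → (sgn (toℕ i) * M i zero) * ∣ minor M i zero ∣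
  det-column {zero}  M = refl
  det-column {suc n} M = +-congˡ (begin
    sum (λ j → (sgn (suc (toℕ j)) * M zero (suc j)) * ∣ minor M zero (suc j) ∣)
      ≈⟨ sum-cong-≋ (λ j → *-congˡ {(sgn (suc (toℕ j)) * M zero (suc j))} (det-column (minor M zero (suc j)))) ⟩
    sum (λ j → row j * sum (λ i → col i * rest i j))
      ≈⟨ sum-cong-≋ (λ j → *-distribˡ-sum (row j) (λ i → col i * rest i j)) ⟩
    sum (λ j → sum λ i → row j * (col i * rest i j))
      ≈⟨ ∑-comm (λ j i → row j * (col i * rest i j)) ⟩
    sum (λ i → sum λ j → row j * (col i * rest i j))
      ≈⟨ sum-cong-≋ (λ i → sum-cong-≋ λ j → solve 6 (λ n s a t b r →
           ((n :* s) :* a) :* ((t :* b) :* r) := ((n :* t) :* b) :* ((s :* a) :* r))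
           refl (- 1#) (sgn (toℕ j)) (M zero (suc j)) (sgn (toℕ i)) (M (suc i) zero) (rest i j)) ⟩
    sum (λ i → sum λ j → col′ i * (row′ j * rest i j))
      ≈⟨ sum-cong-≋ (λ i → *-distribˡ-sum (col′ i) (λ j → row′ j * rest i j)) ⟨
    sum (λ i → col′ i * sum λ j → row′ j * rest i j) ∎)
    where
    row row′ col col′ : Vector Carrier (suc n)
    row  j = sgn (suc (toℕ j)) * M zero (suc j)
    row′ j = sgn (toℕ j) * M zero (suc j)
    col  i = sgn (toℕ i) * M (suc i) zero
    col′ i = sgn (suc (toℕ i)) * M (suc i) zero
    rest : Fin (suc n) → Fin (suc n) → Carrier
    rest i j = ∣ minor (minor M zero (suc j)) i zero ∣

  det-transpose : ∀ {n} (M : Matrix Carrier n) → ∣ flip M ∣ ≈ ∣ M ∣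
  det-transpose {zero}  M = refl
  det-transpose {suc n} M = trans
    (sum-cong-≋ {x = laplace (flip M)} λ j → *-congˡ {sgn (toℕ j) * M j zero} (det-transpose (minor M j zero)))
    (sym (det-column M))

  det-linear : ∀ {n} i (M N P : Matrix Carrier n) a b →
    (∀ j → M i j ≈ a * N i j + b * P i j) →
    (∀ k → k ≢ i → ∀ j → M k j ≈ N k j) →
    (∀ k → k ≢ i → ∀ j → M k j ≈ P k j) →
    ∣ M ∣ ≈ a * ∣ N ∣ + b * ∣ P ∣
  det-linear {suc n} zero M N P a b row M≈N M≈P = trans
    (sum-cong-≋ {x = laplace M} {λ j → a * laplace N j + b * laplace P j} λ j → let s = sgn (toℕ j) in begin
      (s * M zero j) * ∣ minor M zero j ∣
        ≈⟨ *-congʳ (*-congˡ (row j)) ⟩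
      (s * (a * N zero j + b * P zero j)) * ∣ minor M zero j ∣
        ≈⟨ solve 6 (λ s a b x y d → (s :* (a :* x :+ b :* y)) :* d
             := a :* ((s :* x) :* d) :+ b :* ((s :* y) :* d)) refl s a b (N zero j) (P zero j) _ ⟩
      a * ((s * N zero j) * ∣ minor M zero j ∣) + b * ((s * P zero j) * ∣ minor M zero j ∣)
        ≈⟨ +-cong (*-congˡ (*-congˡ (det-cong λ k l → M≈N (suc k) (λ ()) (punchIn j l))))
                  (*-congˡ (*-congˡ (det-cong λ k l → M≈P (suc k) (λ ()) (punchIn j l)))) ⟩
      a * ((s * N zero j) * ∣ minor N zero j ∣) + b * ((s * P zero j) * ∣ minor P zero j ∣) ∎)
    (sum-linear a b (laplace N) (laplace P))
  det-linear {suc n} (suc i) M N P a b row M≈N M≈P = trans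
    (sum-cong-≋ {x = laplace M} {λ j → a * laplace N j + b * laplace P j} λ j → let s = sgn (toℕ j) in begin
      (s * M zero j) * ∣ minor M zero j ∣
        ≈⟨ *-congˡ (det-linear i (minor M zero j) (minor N zero j) (minor P zero j) a b
             (row ∘ punchIn j)
             (λ k k≢i → M≈N (suc k) (k≢i ∘ suc-injective) ∘ punchIn j)
             (λ k k≢i → M≈P (suc k) (k≢i ∘ suc-injective) ∘ punchIn j)) ⟩
      (s * M zero j) * (a * ∣ minor N zero j ∣ + b * ∣ minor P zero j ∣)
        ≈⟨ solve 6 (λ s a b x d e → (s :* x) :* (a :* d :+ b :* e)
             := a :* ((s :* x) :* d) :+ b :* ((s :* x) :* e)) refl s a b (M zero j) _ _ ⟩
      a * ((s * M zero j) * ∣ minor N zero j ∣) + b * ((s * M zero j) * ∣ minor P zero j ∣)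
        ≈⟨ +-cong (*-congˡ (*-congʳ (*-congˡ (M≈N zero (λ ()) j))))
                  (*-congˡ (*-congʳ (*-congˡ (M≈P zero (λ ()) j)))) ⟩
      a * ((s * N zero j) * ∣ minor N zero j ∣) + b * ((s * P zero j) * ∣ minor P zero j ∣) ∎)
    (sum-linear a b (laplace N) (laplace P))

  -- The first two terms of the expansion have equal minors and opposite signs. All later minors
  -- retain both equal columns and vanish by induction.
  det-equalColumns₀₁ : ∀ {n} (M : Matrix Carrier (suc (suc n))) →
    (∀ i → M i zero ≈ M i (suc zero)) → ∣ M ∣ ≈ 0#
  det-equalColumns₀₁ {n} M eq = begin
    t₀ + (t₁ + sum ts)  ≈⟨ +-assoc _ _ _ ⟨
    (t₀ + t₁) + sum ts  ≈⟨ +-cong t₀+t₁≈0 (sum-zero {f = ts} (ts≈0 M eq)) ⟩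
    0# + 0#             ≈⟨ +-identityˡ 0# ⟩
    0#                  ∎
    where
    m₀ = ∣ minor M zero zero ∣
    m₁ = ∣ minor M zero (suc zero) ∣
    t₀ = (1# * M zero zero) * m₀
    t₁ = ((- 1# * 1#) * M zero (suc zero)) * m₁
    ts : Vector Carrier n
    ts j = (sgn (suc (suc (toℕ j))) * M zero (suc (suc j))) * ∣ minor M zero (suc (suc j)) ∣
    m₁≈m₀ : m₁ ≈ m₀
    m₁≈m₀ = det-cong {M = minor M zero (suc zero)} {minor M zero zero} λ { i zero → eq (suc i) ; i (suc j) → refl }
    t₀+t₁≈0 : t₀ + t₁ ≈ 0#
    t₀+t₁≈0 = begin
      t₀ + t₁
        ≈⟨ +-congˡ (*-cong (*-cong (*-identityʳ _) (sym (eq zero))) m₁≈m₀) ⟩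
      (1# * M zero zero) * m₀ + (- 1# * M zero zero) * m₀
        ≈⟨ solve 4 (λ u v x m → (u :* x) :* m :+ (v :* x) :* m := (u :+ v) :* (x :* m))
             refl 1# (- 1#) (M zero zero) m₀ ⟩
      (1# + - 1#) * (M zero zero * m₀)
        ≈⟨ *-congʳ (-‿inverseʳ 1#) ⟩
      0# * (M zero zero * m₀)
        ≈⟨ zeroˡ _ ⟩
      0# ∎
    ts≈0 : ∀ {n} (M : Matrix Carrier (suc (suc n))) → (∀ i → M i zero ≈ M i (suc zero)) → ∀ j →
      (sgn (suc (suc (toℕ j))) * M zero (suc (suc j))) * ∣ minor M zero (suc (suc j)) ∣ ≈ 0#
    ts≈0 {suc n} M eq j = trans
      (*-congˡ (det-equalColumns₀₁ (minor M zero (suc (suc j))) (eq ∘ suc))) (zeroʳ _)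

  setRow : ∀ {n} → Matrix Carrier n → Fin n → Vector Carrier n → Matrix Carrier n
  setRow M i v = updateAt M i (const v)

  det-setRow-linear : ∀ {n} (M : Matrix Carrier n) i a b {u v w} → (∀ j → u j ≈ a * v j + b * w j) →
    ∣ setRow M i u ∣ ≈ a * ∣ setRow M i v ∣ + b * ∣ setRow M i w ∣
  det-setRow-linear M i a b {u} {v} {w} u≈ = det-linear i _ _ _ a b row (agree v) (agree w)
    where
    row : ∀ j → setRow M i u i j ≈ a * setRow M i v i j + b * setRow M i w i j
    row j rewrite updateAt-updates i {f = const u} M | updateAt-updates i {f = const v} M
                | updateAt-updates i {f = const w} M = u≈ j
    agree : ∀ v k → k ≢ i → ∀ j → setRow M i u k j ≈ setRow M i v k j
    agree v k k≢i j = reflexive (≡.cong-app (≡.trans (updateAt-minimal k i M k≢i)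
      (≡.sym (updateAt-minimal k i M k≢i))) j)

  -- Stated for a single pair of rows, so that swaps of pairs already settled are available while
  -- the other pairs are being proved.
  Alternating : ∀ {n} (i j : Fin n) → Set _
  Alternating {n} i j = (M : Matrix Carrier n) → (∀ k → M i k ≈ M j k) → ∣ M ∣ ≈ 0#

  -- Polarisation: as a bilinear function of the two rows, the determinant vanishes on equal
  -- arguments, and expanding it at the sum of the rows in both places leaves the two mixed terms.
  det-swap : ∀ {n} {i j : Fin n} → i ≢ j → Alternating i j →
    ∀ M → ∣ M ∘ PC.transpose i j ∣ ≈ - ∣ M ∣
  det-swap {n} {i} {j} i≢j alt M = begin
    ∣ M ∘ PC.transpose i j ∣  ≈⟨ det-cong (λ k l → reflexive (≡.cong-app (swapped k) l)) ⟩
    D (M j) (M i)             ≈⟨ +-inverseʳ-unique _ _ (trans (sym D-sum) (D-alt _)) ⟩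
    - D (M i) (M j)           ≈⟨ -‿cong (det-cong λ k l → reflexive (≡.cong-app (same k) l)) ⟩
    - ∣ M ∣                   ∎
    where
    rows : Vector Carrier n → Vector Carrier n → Matrix Carrier n
    rows v w = setRow (setRow M j w) i v
    D : Vector Carrier n → Vector Carrier n → Carrier
    D v w = ∣ rows v w ∣
    rowᵢ : ∀ v w → rows v w i ≡ v
    rowᵢ v w = updateAt-updates i (setRow M j w)
    rowⱼ : ∀ v w → rows v w j ≡ w
    rowⱼ v w = ≡.trans (updateAt-minimal j i _ (i≢j ∘ ≡.sym)) (updateAt-updates j M)
    rowₖ : ∀ v w {k} → k ≢ i → k ≢ j → rows v w k ≡ M k
    rowₖ v w k≢i k≢j = ≡.trans (updateAt-minimal _ i _ k≢i) (updateAt-minimal _ j M k≢j)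
    same : ∀ k → rows (M i) (M j) k ≡ M k
    same k with k ≟ i
    ... | yes ≡.refl = rowᵢ _ _
    ... | no k≢i with k ≟ j
    ...   | yes ≡.refl = rowⱼ (M i) _
    ...   | no k≢j     = rowₖ _ _ k≢i k≢j
    swapped : ∀ k → M (PC.transpose i j k) ≡ rows (M j) (M i) k
    swapped k with k ≟ i
    ... | yes ≡.refl = ≡.sym (rowᵢ _ _)
    ... | no k≢i with k ≟ j
    ...   | yes ≡.refl = ≡.sym (rowⱼ (M j) _)
    ...   | no k≢j     = ≡.sym (rowₖ _ _ k≢i k≢j)
    D-alt : ∀ v → D v v ≈ 0#
    D-alt v = alt (rows v v) λ l → reflexive (≡.cong-app (≡.trans (rowᵢ v v) (≡.sym (rowⱼ v v))) l)
    _⊕_ : Vector Carrier n → Vector Carrier n → Vector Carrier n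
    (v ⊕ w) l = 1# * v l + 1# * w l
    addˡ : ∀ u v w → D (u ⊕ v) w ≈ D u w + D v w
    addˡ u v w = trans (det-setRow-linear (setRow M j w) i 1# 1# (λ _ → refl))
      (+-cong (*-identityˡ _) (*-identityˡ _))
    addʳ : ∀ u v w → D u (v ⊕ w) ≈ D u v + D u w
    addʳ u v w = trans
      (det-linear j (rows u (v ⊕ w)) (rows u v) (rows u w) 1# 1# row (agree v) (agree w))
      (+-cong (*-identityˡ _) (*-identityˡ _))
      where
      row : ∀ l → rows u (v ⊕ w) j l ≈ 1# * rows u v j l + 1# * rows u w j l
      row l rewrite rowⱼ u (v ⊕ w) | rowⱼ u v | rowⱼ u w = refl
      agree : ∀ x k → k ≢ j → ∀ l → rows u (v ⊕ w) k l ≈ rows u x k l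
      agree x k k≢j l with k ≟ i
      ... | yes ≡.refl = reflexive (≡.cong-app (≡.trans (rowᵢ u (v ⊕ w)) (≡.sym (rowᵢ u x))) l)
      ... | no k≢i = reflexive (≡.cong-app
              (≡.trans (rowₖ u (v ⊕ w) k≢i k≢j) (≡.sym (rowₖ u x k≢i k≢j))) l)
    D-sum : D (M i ⊕ M j) (M i ⊕ M j) ≈ D (M i) (M j) + D (M j) (M i)
    D-sum = begin
      D (M i ⊕ M j) (M i ⊕ M j)
        ≈⟨ addˡ _ _ _ ⟩
      D (M i) (M i ⊕ M j) + D (M j) (M i ⊕ M j)
        ≈⟨ +-cong (addʳ _ _ _) (addʳ _ _ _) ⟩
      (D (M i) (M i) + D (M i) (M j)) + (D (M j) (M i) + D (M j) (M j))
        ≈⟨ +-cong (trans (+-congʳ (D-alt _)) (+-identityˡ _)) (trans (+-congˡ (D-alt _)) (+-identityʳ _)) ⟩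
      D (M i) (M j) + D (M j) (M i) ∎

  alternating : ∀ {n} {i j : Fin n} → i ≢ j → Alternating i j
  alternating-suc : ∀ {n} {i j : Fin n} → i ≢ j → Alternating (suc i) (suc j)

  alternating-suc i≢j M eq = sum-zero {f = laplace M} λ k → trans
    (*-congˡ (alternating i≢j (minor M zero k) (eq ∘ punchIn k))) (zeroʳ _)

  -- Row j + 2 is brought next to row 0 by a swap with row 1.
  alternating-zero : ∀ {n} (j : Fin n) → Alternating zero (suc j)
  alternating-zero {suc n} zero M eq = trans (sym (det-transpose M)) (det-equalColumns₀₁ (flip M) eq)
  alternating-zero {suc n} (suc j) M eq = begin
    ∣ M ∣                          ≈⟨ -‿involutive _ ⟨
    - (- ∣ M ∣)                    ≈⟨ -‿cong (det-swap 1≢2+j (alternating-suc λ ()) M) ⟨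
    - ∣ M ∘ PC.transpose 1F 2+j ∣  ≈⟨ -‿cong (alternating-zero zero (M ∘ PC.transpose 1F 2+j) eq) ⟩
    - 0#                           ≈⟨ trans (sym (+-identityʳ _)) (-‿inverseˡ 0#) ⟩
    0#                             ∎
    where
    1F 2+j : Fin (suc (suc n))
    1F  = suc zero
    2+j = suc (suc j)
    1≢2+j : 1F ≢ 2+j
    1≢2+j ()

  alternating {i = zero}  {zero}  i≢j = contradiction ≡.refl i≢j
  alternating {i = zero}  {suc j} i≢j = alternating-zero j
  alternating {i = suc i} {zero}  i≢j M eq = alternating-zero i M (sym ∘ eq)
  alternating {i = suc i} {suc j} i≢j = alternating-suc (i≢j ∘ ≡.cong suc)

  -- Rows and columns are swapped together, so the two signs cancel; the column swap is a row swap
  -- of the transpose. A transposition of an index with itself is no swap and is treated apart.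
  det-transposition : ∀ {n} (i j : Fin n) (M : Matrix Carrier n) →
    ∣ (λ k l → M (PC.transpose i j k) (PC.transpose i j l)) ∣ ≈ ∣ M ∣
  det-transposition i j M with i ≟ j
  ... | yes ≡.refl = det-cong λ k l → reflexive (≡.cong₂ M (fixed k) (fixed l))
    where
    fixed : ∀ k → PC.transpose i i k ≡ k
    fixed k with k ≟ i
    ... | yes k≡i = ≡.sym k≡i
    ... | no k≢i with k ≟ i
    ...   | yes k≡i = ≡.sym k≡i
    ...   | no _    = ≡.refl
  ... | no i≢j = begin
    ∣ (λ k l → M (τ k) (τ l)) ∣  ≈⟨ det-swap i≢j (alternating i≢j) (λ k l → M k (τ l)) ⟩
    - ∣ (λ k l → M k (τ l)) ∣    ≈⟨ -‿cong (det-transpose (λ k l → M k (τ l))) ⟨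
    - ∣ (λ k l → M l (τ k)) ∣    ≈⟨ -‿cong (det-swap i≢j (alternating i≢j) (flip M)) ⟩
    - (- ∣ flip M ∣)             ≈⟨ -‿involutive _ ⟩
    ∣ flip M ∣                   ≈⟨ det-transpose M ⟩
    ∣ M ∣                        ∎
    where τ = PC.transpose i j

  det-permute : ∀ {m n} (π : Permutation m n) (M : Matrix Carrier n) →
    ∣ (λ i j → M (π ⟨$⟩ʳ i) (π ⟨$⟩ʳ j)) ∣ ≈ ∣ M ∣
  det-permute π M with ↔⇒≡ π
  ... | ≡.refl = trans
    (det-cong λ i j → reflexive (≡.cong₂ M (≡.sym (eval-decompose π i)) (≡.sym (eval-decompose π j))))
    (transpositions (decompose π) M)
    where
    transpositions : ∀ {n} (ts : TranspositionList n) (M : Matrix Carrier n) →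
      ∣ (λ i j → M (eval ts ⟨$⟩ʳ i) (eval ts ⟨$⟩ʳ j)) ∣ ≈ ∣ M ∣
    transpositions []             M = refl
    transpositions ((i , j) ∷ ts) M = trans
      (det-transposition i j λ k l → M (eval ts ⟨$⟩ʳ k) (eval ts ⟨$⟩ʳ l)) (transpositions ts M)

  -- Block matrices and row operations

  topLeft : ∀ m {k} → Matrix Carrier (m ℕ.+ k) → Matrix Carrier m
  topLeft m {k} M i j = M (i ↑ˡ k) (j ↑ˡ k)

  bottomRight : ∀ m {k} → Matrix Carrier (m ℕ.+ k) → Matrix Carrier k
  bottomRight m M i j = M (m ↑ʳ i) (m ↑ʳ j)

  private
    punchIn-↑ˡ : ∀ {m} k (j : Fin (suc m)) l → punchIn (j ↑ˡ k) (l ↑ˡ k) ≡ punchIn j l ↑ˡ k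
    punchIn-↑ˡ k zero    l       = ≡.refl
    punchIn-↑ˡ k (suc j) zero    = ≡.refl
    punchIn-↑ˡ k (suc j) (suc l) = ≡.cong suc (punchIn-↑ˡ k j l)

    punchIn-↑ʳ : ∀ {m} k (j : Fin (suc m)) (l : Fin k) → punchIn (j ↑ˡ k) (m ↑ʳ l) ≡ suc m ↑ʳ l
    punchIn-↑ʳ         k zero    l = ≡.refl
    punchIn-↑ʳ {suc m} k (suc j) l = ≡.cong suc (punchIn-↑ʳ k j l)

  -- Induction on the size of the upper block: in the expansion along the first row only columns of
  -- that block contribute, and their minors are block triangular with the same lower block.
  det-lowerTriangular : ∀ m {k} (M : Matrix Carrier (m ℕ.+ k)) →
    (∀ i j → M (i ↑ˡ k) (m ↑ʳ j) ≈ 0#) → ∣ M ∣ ≈ ∣ topLeft m M ∣ * ∣ bottomRight m M ∣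
  det-lowerTriangular zero        M M≈0 = sym (*-identityˡ _)
  det-lowerTriangular (suc m) {k} M M≈0 = begin
    ∣ M ∣
      ≈⟨ sum-++ (suc m) term ⟩
    sum (λ j → term (j ↑ˡ k)) + sum (λ j → term (suc m ↑ʳ j))
      ≈⟨ +-cong (sum-cong-≋ left) (sum-zero λ j → trans
           (*-congʳ (trans (*-congˡ (M≈0 zero j)) (zeroʳ _))) (zeroˡ _)) ⟩
    sum (λ j → d * termˡ j) + 0#
      ≈⟨ +-identityʳ _ ⟩
    sum (λ j → d * termˡ j)
      ≈⟨ *-distribˡ-sum d termˡ ⟨
    d * ∣ topLeft (suc m) M ∣
      ≈⟨ *-comm _ _ ⟩
    ∣ topLeft (suc m) M ∣ * d ∎
    where
    d = ∣ bottomRight (suc m) M ∣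
    term  = laplace M
    termˡ = laplace (topLeft (suc m) M)
    toℕ-↑ˡ : ∀ {m} (j : Fin m) → toℕ (j ↑ˡ k) ≡ toℕ j
    toℕ-↑ˡ zero    = ≡.refl
    toℕ-↑ˡ (suc j) = ≡.cong suc (toℕ-↑ˡ j)
    left : ∀ j → term (j ↑ˡ k) ≈ d * termˡ j
    left j = begin
      (sgn (toℕ (j ↑ˡ k)) * x) * ∣ minor M zero (j ↑ˡ k) ∣
        ≈⟨ *-cong (*-congʳ (reflexive (≡.cong sgn (toℕ-↑ˡ j))))
             (det-lowerTriangular m (minor M zero (j ↑ˡ k)) λ i l → trans
               (reflexive (≡.cong (M (suc i ↑ˡ k)) (punchIn-↑ʳ k j l))) (M≈0 (suc i) l)) ⟩
      (sgn (toℕ j) * x) * (∣ topLeft m (minor M zero (j ↑ˡ k)) ∣ * ∣ bottomRight m (minor M zero (j ↑ˡ k)) ∣)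
        ≈⟨ *-congˡ (*-cong
             (det-cong λ i l → reflexive (≡.cong (M (suc i ↑ˡ k)) (punchIn-↑ˡ k j l)))
             (det-cong λ i l → reflexive (≡.cong (M (suc m ↑ʳ i)) (punchIn-↑ʳ k j l)))) ⟩
      (sgn (toℕ j) * x) * (∣ minor (topLeft (suc m) M) zero j ∣ * d)
        ≈⟨ solve 4 (λ s x e d → (s :* x) :* (e :* d) := d :* ((s :* x) :* e)) refl (sgn (toℕ j)) x _ d ⟩
      d * termˡ j ∎
      where x = M zero (j ↑ˡ k)

  det-upperTriangular : ∀ m {k} (M : Matrix Carrier (m ℕ.+ k)) →
    (∀ i j → M (m ↑ʳ i) (j ↑ˡ k) ≈ 0#) → ∣ M ∣ ≈ ∣ topLeft m M ∣ * ∣ bottomRight m M ∣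
  det-upperTriangular m M M≈0 = begin
    ∣ M ∣                                            ≈⟨ det-transpose M ⟨
    ∣ flip M ∣                                       ≈⟨ det-lowerTriangular m (flip M) (flip M≈0) ⟩
    ∣ flip (topLeft m M) ∣ * ∣ flip (bottomRight m M) ∣
      ≈⟨ *-cong (det-transpose (topLeft m M)) (det-transpose (bottomRight m M)) ⟩
    ∣ topLeft m M ∣ * ∣ bottomRight m M ∣            ∎

  det-scale : ∀ {n} a (M : Matrix Carrier n) → ∣ (λ i j → a * M i j) ∣ ≈ a ^ n * ∣ M ∣
  det-scale {zero}  a M = sym (*-identityˡ 1#)
  det-scale {suc n} a M = trans
    (sum-cong-≋ {x = laplace λ i j → a * M i j} λ j → trans (*-congˡ (det-scale a (minor M zero j)))
      (solve 5 (λ s a x b d → (s :* (a :* x)) :* (b :* d) := (a :* b) :* ((s :* x) :* d))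
        refl (sgn (toℕ j)) a (M zero j) (a ^ n) ∣ minor M zero j ∣))
    (sym (*-distribˡ-sum (a ^ suc n) (laplace M)))

  -- By linearity in row `i`, each added multiple of another row contributes a determinant with two
  -- equal rows.
  det-addRows : ∀ {n m} i (ι : Fin m → Fin n) → (∀ f → ι f ≢ i) →
    ∀ β (γ : Vector Carrier m) (M N : Matrix Carrier n) →
    (∀ j → M i j ≈ β * N i j + sum (λ f → γ f * N (ι f) j)) →
    (∀ k → k ≢ i → ∀ j → M k j ≈ N k j) →
    ∣ M ∣ ≈ β * ∣ N ∣
  det-addRows {n} i ι ι≢i β γ M N row agree = begin
    ∣ M ∣
      ≈⟨ det-linear i M N (setRow N i (comb γ ι)) β 1# row′ agree (λ k k≢i j → trans (agree k k≢i j)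
           (reflexive (≡.sym (≡.cong-app (updateAt-minimal k i N k≢i) j)))) ⟩
    β * ∣ N ∣ + 1# * ∣ setRow N i (comb γ ι) ∣
      ≈⟨ +-congˡ (trans (*-identityˡ _) (comb≈0 γ ι ι≢i)) ⟩
    β * ∣ N ∣ + 0#
      ≈⟨ +-identityʳ _ ⟩
    β * ∣ N ∣ ∎
    where
    comb : ∀ {m} → Vector Carrier m → (Fin m → Fin n) → Vector Carrier n
    comb γ ι j = sum λ f → γ f * N (ι f) j
    row′ : ∀ j → M i j ≈ β * N i j + 1# * setRow N i (comb γ ι) i j
    row′ j rewrite updateAt-updates i {f = const (comb γ ι)} N =
      trans (row j) (+-congˡ (sym (*-identityˡ _)))
    equal : ∀ f → f ≢ i → ∣ setRow N i (N f) ∣ ≈ 0#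
    equal f f≢i = alternating f≢i (setRow N i (N f)) λ j → reflexive (≡.cong-app
      (≡.trans (updateAt-minimal f i N f≢i) (≡.sym (updateAt-updates i N))) j)
    comb≈0 : ∀ {m} (γ : Vector Carrier m) ι → (∀ f → ι f ≢ i) → ∣ setRow N i (comb γ ι) ∣ ≈ 0#
    -- An empty combination is a zero row, written as 0 times a row plus 0 times a row so that
    -- linearity applies.
    comb≈0 {zero} γ ι ι≢i = trans
      (det-setRow-linear N i 0# 0# {v = N i} {w = N i} λ j → sym (trans (+-cong (zeroˡ _) (zeroˡ _)) (+-identityˡ _)))
      (trans (+-cong (zeroˡ _) (zeroˡ _)) (+-identityˡ _))
    comb≈0 {suc m} γ ι ι≢i = trans
      (det-setRow-linear N i (γ zero) 1# λ j → +-congˡ (sym (*-identityˡ _)))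
      (trans (+-cong (trans (*-congˡ (equal (ι zero) (ι≢i zero))) (zeroʳ _))
                     (trans (*-identityˡ _) (comb≈0 (tail γ) (ι ∘ suc) (ι≢i ∘ suc))))
             (+-identityˡ _))

  -- Changes the rows one at a time, each change costing a factor β. The recursion fixes the first
  -- row at its new value and so alters the function `D`, which must therefore be arbitrary.
  -- `D-cong` takes the place of function extensionality, since a vector and its head put back onto
  -- its tail agree only pointwise.
  stepwise : ∀ {k a s} {Row : Set a} β (D : Vector Row k → Carrier) (S : Fin k → Row → Row → Set s) →
    (∀ v v′ → (∀ j → v′ j ≡ v j) → D v′ ≈ D v) →
    (∀ i v v′ → (∀ j → j ≢ i → v′ j ≡ v j) → S i (v i) (v′ i) → D v′ ≈ β * D v) →
    ∀ v v′ → (∀ i → S i (v i) (v′ i)) → D v′ ≈ β ^ k * D v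
  stepwise {zero}  β D S D-cong step v v′ s = trans (D-cong v v′ λ ()) (sym (*-identityˡ _))
  stepwise {suc k} β D S D-cong step v v′ s = begin
    D v′                              ≈⟨ D-cong _ _ (λ { zero → ≡.refl ; (suc j) → ≡.refl }) ⟩
    D (v′ zero ◂ tail v′)             ≈⟨ stepwise β (λ u → D (v′ zero ◂ u)) (S ∘ suc)
                                           (λ u u′ eq → D-cong _ _ λ { zero → ≡.refl ; (suc j) → eq j })
                                           (λ i u u′ eq → step (suc i) (v′ zero ◂ u) (v′ zero ◂ u′)
                                             λ { zero _ → ≡.refl ; (suc j) ne → eq j (ne ∘ ≡.cong suc) })
                                           (tail v) (tail v′) (s ∘ suc) ⟩
    β ^ k * D (v′ zero ◂ tail v)      ≈⟨ *-congˡ (step zero v (v′ zero ◂ tail v)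
                                           (λ { zero ne → contradiction ≡.refl ne ; (suc j) _ → ≡.refl }) (s zero)) ⟩
    β ^ k * (β * D v)                 ≈⟨ solve 3 (λ p b d → p :* (b :* d) := (b :* p) :* d) refl (β ^ k) β (D v) ⟩
    β ^ suc k * D v                   ∎

  -- Replacing each row i below the first m by β (row i) - w i (sum of the first m rows)
  -- clears the block below the top left one.
  det-bordered : ∀ m {k} (M : Matrix Carrier (m ℕ.+ k)) β (w : Vector Carrier k) →
    (∀ i f → M (m ↑ʳ i) (f ↑ˡ k) ≈ w i) →
    (∀ f → sum (λ g → M (g ↑ˡ k) (f ↑ˡ k)) ≈ β) →
    β ^ k * ∣ M ∣ ≈ ∣ topLeft m M ∣ *
      ∣ (λ i j → β * M (m ↑ʳ i) (m ↑ʳ j) + sum (λ g → - w i * M (g ↑ˡ k) (m ↑ʳ j))) ∣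
  det-bordered m {k} M β w border colSum = begin
    β ^ k * ∣ M ∣
      ≈⟨ *-congˡ (det-cong M≈) ⟩
    β ^ k * D bot
      ≈⟨ stepwise β D S D-cong step bot bot′ (λ i j → refl) ⟨
    ∣ M′ ∣
      ≈⟨ det-upperTriangular m M′ cleared ⟩
    ∣ topLeft m M′ ∣ * ∣ bottomRight m M′ ∣
      ≈⟨ *-cong (det-cong λ i j → reflexive (≡.cong-app (rowˡ bot′ i) (j ↑ˡ k)))
                (det-cong λ i j → reflexive (≡.cong-app (rowʳ bot′ i) (m ↑ʳ j))) ⟩
    _ ∎
    where
    Row = Vector Carrier (m ℕ.+ k)
    top : Vector Row m
    top g = M (g ↑ˡ k)
    bot bot′ : Vector Row k
    bot i = M (m ↑ʳ i)
    bot′ i j = β * M (m ↑ʳ i) j + sum (λ g → - w i * top g j)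
    D : Vector Row k → Carrier
    D v = ∣ top ++ v ∣
    M′ = top ++ bot′
    rowˡ : ∀ v g → (top ++ v) (g ↑ˡ k) ≡ top g
    rowˡ v g rewrite splitAt-↑ˡ m g k = ≡.refl
    rowʳ : ∀ v i → (top ++ v) (m ↑ʳ i) ≡ v i
    rowʳ v i rewrite splitAt-↑ʳ m k i = ≡.refl
    -- The operation refers to the upper rows only. These never change, so the description of each
    -- step does not depend on the steps already made.
    S : Fin k → Row → Row → Set _
    S i u u′ = ∀ j → u′ j ≈ β * u j + sum (λ g → - w i * top g j)
    D-cong : ∀ v v′ → (∀ j → v′ j ≡ v j) → D v′ ≈ D v
    D-cong v v′ eq = det-cong λ i j → reflexive (≡.cong-app (go i) j)
      where
      go : ∀ i → (top ++ v′) i ≡ (top ++ v) i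
      go i with splitAt m i
      ... | inj₁ _ = ≡.refl
      ... | inj₂ l = eq l
    step : ∀ i v v′ → (∀ j → j ≢ i → v′ j ≡ v j) → S i (v i) (v′ i) → D v′ ≈ β * D v
    step i v v′ eq s = det-addRows (m ↑ʳ i) (_↑ˡ k) ↑ˡ≢↑ʳ β (λ _ → - w i) (top ++ v′) (top ++ v) row agree
      where
      ↑ˡ≢↑ʳ : ∀ f → f ↑ˡ k ≢ m ↑ʳ i
      ↑ˡ≢↑ʳ f p with ≡.trans (≡.sym (splitAt-↑ˡ m f k)) (≡.trans (≡.cong (splitAt m) p) (splitAt-↑ʳ m k i))
      ... | ()
      row : ∀ j → (top ++ v′) (m ↑ʳ i) j ≈
        β * (top ++ v) (m ↑ʳ i) j + sum (λ g → - w i * (top ++ v) (g ↑ˡ k) j)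
      row j rewrite rowʳ v′ i | rowʳ v i = trans (s j)
        (+-congˡ (sum-cong-≋ λ g → *-congˡ (reflexive (≡.sym (≡.cong-app (rowˡ v g) j)))))
      agree : ∀ l → l ≢ m ↑ʳ i → ∀ j → (top ++ v′) l j ≈ (top ++ v) l j
      agree l l≢i j with splitAt m l in e
      ... | inj₁ _ = refl
      ... | inj₂ x = reflexive (≡.cong-app
              (eq x λ { ≡.refl → l≢i (≡.sym (splitAt⁻¹-↑ʳ e)) }) j)
    M≈ : ∀ i j → M i j ≈ (top ++ bot) i j
    M≈ i j with splitAt m i in e
    ... | inj₁ g = reflexive (≡.cong (λ x → M x j) (≡.sym (splitAt⁻¹-↑ˡ e)))
    ... | inj₂ l = reflexive (≡.cong (λ x → M x j) (≡.sym (splitAt⁻¹-↑ʳ e)))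
    cleared : ∀ i f → M′ (m ↑ʳ i) (f ↑ˡ k) ≈ 0#
    cleared i f = begin
      M′ (m ↑ʳ i) (f ↑ˡ k)
        ≈⟨ reflexive (≡.cong-app (rowʳ bot′ i) (f ↑ˡ k)) ⟩
      β * M (m ↑ʳ i) (f ↑ˡ k) + sum (λ g → - w i * top g (f ↑ˡ k))
        ≈⟨ +-cong (*-congˡ (border i f)) (sym (*-distribˡ-sum (- w i) (λ g → top g (f ↑ˡ k)))) ⟩
      β * w i + - w i * sum (λ g → top g (f ↑ˡ k))
        ≈⟨ +-cong (*-comm _ _) (*-congˡ (colSum f)) ⟩
      w i * β + - w i * β
        ≈⟨ distribʳ β (w i) (- w i) ⟨
      (w i + - w i) * β
        ≈⟨ trans (*-congʳ (-‿inverseʳ _)) (zeroˡ _) ⟩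
      0# ∎

-- Polynomials

module PolynomialRing {c ℓ} (R : CommutativeRing c ℓ) where
  open CommutativeRing R hiding (zero)
  open import Algebra.Properties.Ring ring using (-0#≈0#)
  open import Algebra.Solver.Ring.NaturalCoefficients.Default commutativeSemiring
    using (solve; _:=_; _:+_; _:*_)
  open import Relation.Binary.Reasoning.Setoid setoid
  open Polynomial rawRing public

  coeff-+ : ∀ p q k → coeff (p +ᴾ q) k ≈ coeff p k + coeff q k
  coeff-+ []      q       k       = sym (+-identityˡ _)
  coeff-+ (x ∷ p) []      k       = sym (+-identityʳ _)
  coeff-+ (x ∷ p) (y ∷ q) zero    = refl
  coeff-+ (x ∷ p) (y ∷ q) (suc k) = coeff-+ p q k

  coeff-scale : ∀ a p k → coeff (map (a *_) p) k ≈ a * coeff p k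
  coeff-scale a []      k       = sym (zeroʳ a)
  coeff-scale a (x ∷ p) zero    = refl
  coeff-scale a (x ∷ p) (suc k) = coeff-scale a p k

  coeff-neg : ∀ p k → coeff (map -_ p) k ≈ - coeff p k
  coeff-neg []      k       = sym -0#≈0#
  coeff-neg (x ∷ p) zero    = refl
  coeff-neg (x ∷ p) (suc k) = coeff-neg p k

  coeff-*-zero : ∀ x p q → coeff ((x ∷ p) *ᴾ q) 0 ≈ x * coeff q 0
  coeff-*-zero x p q = trans (coeff-+ (map (x *_) q) _ 0)
    (trans (+-cong (coeff-scale x q 0) refl) (+-identityʳ _))

  coeff-*-suc : ∀ x p q k → coeff ((x ∷ p) *ᴾ q) (suc k) ≈ x * coeff q (suc k) + coeff (p *ᴾ q) k
  coeff-*-suc x p q k = trans (coeff-+ (map (x *_) q) _ (suc k))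
    (+-congʳ (coeff-scale x q (suc k)))

  private
    +ᴾ-cong : ∀ {p p′ q q′} → p ≋ p′ → q ≋ q′ → (p +ᴾ q) ≋ (p′ +ᴾ q′)
    +ᴾ-cong {p} {p′} {q} {q′} p≋p′ q≋q′ k =
      trans (coeff-+ p q k) (trans (+-cong (p≋p′ k) (q≋q′ k)) (sym (coeff-+ p′ q′ k)))

    *ᴾ-congˡ : ∀ p {q q′} → q ≋ q′ → (p *ᴾ q) ≋ (p *ᴾ q′)
    *ᴾ-congˡ []      q≋q′ k = refl
    *ᴾ-congˡ (x ∷ p) {q} {q′} q≋q′ zero    =
      trans (coeff-*-zero x p q) (trans (*-congˡ (q≋q′ 0)) (sym (coeff-*-zero x p q′)))
    *ᴾ-congˡ (x ∷ p) {q} {q′} q≋q′ (suc k) = trans (coeff-*-suc x p q k)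
      (trans (+-cong (*-congˡ (q≋q′ (suc k))) (*ᴾ-congˡ p q≋q′ k)) (sym (coeff-*-suc x p q′ k)))

    *ᴾ-zeroʳ : ∀ p → (p *ᴾ []) ≋ []
    *ᴾ-zeroʳ []      k       = refl
    *ᴾ-zeroʳ (x ∷ p) zero    = refl
    *ᴾ-zeroʳ (x ∷ p) (suc k) = *ᴾ-zeroʳ p k

    -- Multiplication recurses on its first factor; unfolding the second one as well turns
    -- commutativity into an induction.
    *ᴾ-cons : ∀ p y q → (p *ᴾ (y ∷ q)) ≋ (map (y *_) p +ᴾ (0# ∷ (p *ᴾ q)))
    *ᴾ-cons []      y q zero    = refl
    *ᴾ-cons []      y q (suc k) = refl
    *ᴾ-cons (x ∷ p) y q zero    = +-congʳ (*-comm x y)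
    *ᴾ-cons (x ∷ p) y q (suc k) = begin
      coeff ((x ∷ p) *ᴾ (y ∷ q)) (suc k)
        ≈⟨ coeff-*-suc x p (y ∷ q) k ⟩
      x * coeff q k + coeff (p *ᴾ (y ∷ q)) k
        ≈⟨ +-congˡ (trans (*ᴾ-cons p y q k) (coeff-+ (map (y *_) p) _ k)) ⟩
      x * coeff q k + (coeff (map (y *_) p) k + coeff (0# ∷ (p *ᴾ q)) k)
        ≈⟨ solve 3 (λ a b c → a :+ (b :+ c) := b :+ (a :+ c)) refl _ _ _ ⟩
      coeff (map (y *_) p) k + (x * coeff q k + coeff (0# ∷ (p *ᴾ q)) k)
        ≈⟨ +-congˡ (+-congʳ (coeff-scale x q k)) ⟨
      coeff (map (y *_) p) k + (coeff (map (x *_) q) k + coeff (0# ∷ (p *ᴾ q)) k)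
        ≈⟨ +-congˡ (coeff-+ (map (x *_) q) _ k) ⟨
      coeff (map (y *_) p) k + coeff ((x ∷ p) *ᴾ q) k
        ≈⟨ coeff-+ (map (y *_) p) _ k ⟨
      coeff (map (y *_) (x ∷ p) +ᴾ (0# ∷ ((x ∷ p) *ᴾ q))) (suc k) ∎

    ∷-cong : ∀ {x y p q} → x ≈ y → p ≋ q → (x ∷ p) ≋ (y ∷ q)
    ∷-cong x≈y p≋q zero    = x≈y
    ∷-cong x≈y p≋q (suc k) = p≋q k

    *ᴾ-comm : ∀ p q → (p *ᴾ q) ≋ (q *ᴾ p)
    *ᴾ-comm p []      k = *ᴾ-zeroʳ p k
    *ᴾ-comm p (y ∷ q) k = trans (*ᴾ-cons p y q k)
      (+ᴾ-cong {map (y *_) p} {map (y *_) p} {0# ∷ (p *ᴾ q)} {0# ∷ (q *ᴾ p)} (λ _ → refl)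
        (∷-cong {p = p *ᴾ q} {q *ᴾ p} refl (*ᴾ-comm p q)) k)

    -- Equal polynomials may be lists of different lengths, which makes recursion on the first
    -- factor awkward. Commutativity moves the question to the second factor.
    *ᴾ-cong : ∀ {p p′ q q′} → p ≋ p′ → q ≋ q′ → (p *ᴾ q) ≋ (p′ *ᴾ q′)
    *ᴾ-cong {p} {p′} {q} {q′} p≋p′ q≋q′ k = begin
      coeff (p *ᴾ q) k    ≈⟨ *ᴾ-congˡ p {q} {q′} q≋q′ k ⟩
      coeff (p *ᴾ q′) k   ≈⟨ *ᴾ-comm p q′ k ⟩
      coeff (q′ *ᴾ p) k   ≈⟨ *ᴾ-congˡ q′ {p} {p′} p≋p′ k ⟩
      coeff (q′ *ᴾ p′) k  ≈⟨ *ᴾ-comm q′ p′ k ⟩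
      coeff (p′ *ᴾ q′) k  ∎

    *ᴾ-distribˡ : ∀ p q r → (p *ᴾ (q +ᴾ r)) ≋ ((p *ᴾ q) +ᴾ (p *ᴾ r))
    *ᴾ-distribˡ []      q r k       = refl
    *ᴾ-distribˡ (x ∷ p) q r zero    = begin
      coeff ((x ∷ p) *ᴾ (q +ᴾ r)) 0
        ≈⟨ coeff-*-zero x p (q +ᴾ r) ⟩
      x * coeff (q +ᴾ r) 0
        ≈⟨ trans (*-congˡ (coeff-+ q r 0)) (distribˡ x _ _) ⟩
      x * coeff q 0 + x * coeff r 0
        ≈⟨ +-cong (coeff-*-zero x p q) (coeff-*-zero x p r) ⟨
      coeff ((x ∷ p) *ᴾ q) 0 + coeff ((x ∷ p) *ᴾ r) 0
        ≈⟨ coeff-+ ((x ∷ p) *ᴾ q) _ 0 ⟨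
      _ ∎
    *ᴾ-distribˡ (x ∷ p) q r (suc k) = begin
      coeff ((x ∷ p) *ᴾ (q +ᴾ r)) (suc k)
        ≈⟨ coeff-*-suc x p (q +ᴾ r) k ⟩
      x * coeff (q +ᴾ r) (suc k) + coeff (p *ᴾ (q +ᴾ r)) k
        ≈⟨ +-cong (*-congˡ (coeff-+ q r (suc k)))
             (trans (*ᴾ-distribˡ p q r k) (coeff-+ (p *ᴾ q) _ k)) ⟩
      x * (coeff q (suc k) + coeff r (suc k)) + (coeff (p *ᴾ q) k + coeff (p *ᴾ r) k)
        ≈⟨ solve 5 (λ x a b c d → x :* (a :+ b) :+ (c :+ d) := (x :* a :+ c) :+ (x :* b :+ d))
             refl x _ _ _ _ ⟩
      (x * coeff q (suc k) + coeff (p *ᴾ q) k) + (x * coeff r (suc k) + coeff (p *ᴾ r) k)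
        ≈⟨ +-cong (coeff-*-suc x p q k) (coeff-*-suc x p r k) ⟨
      coeff ((x ∷ p) *ᴾ q) (suc k) + coeff ((x ∷ p) *ᴾ r) (suc k)
        ≈⟨ coeff-+ ((x ∷ p) *ᴾ q) _ (suc k) ⟨
      _ ∎

    *ᴾ-distribʳ : ∀ p q r → ((q +ᴾ r) *ᴾ p) ≋ ((q *ᴾ p) +ᴾ (r *ᴾ p))
    *ᴾ-distribʳ p q r k = trans (*ᴾ-comm (q +ᴾ r) p k) (trans (*ᴾ-distribˡ p q r k)
      (+ᴾ-cong {p *ᴾ q} {q *ᴾ p} {p *ᴾ r} {r *ᴾ p} (*ᴾ-comm p q) (*ᴾ-comm p r) k))

    scale-*ᴾ : ∀ a p q → (map (a *_) p *ᴾ q) ≋ map (a *_) (p *ᴾ q)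
    scale-*ᴾ a []      q k       = refl
    scale-*ᴾ a (x ∷ p) q zero    = begin
      coeff (map (a *_) (x ∷ p) *ᴾ q) 0   ≈⟨ coeff-*-zero (a * x) (map (a *_) p) q ⟩
      (a * x) * coeff q 0                 ≈⟨ *-assoc _ _ _ ⟩
      a * (x * coeff q 0)                 ≈⟨ *-congˡ (coeff-*-zero x p q) ⟨
      a * coeff ((x ∷ p) *ᴾ q) 0          ≈⟨ coeff-scale a ((x ∷ p) *ᴾ q) 0 ⟨
      _                                   ∎
    scale-*ᴾ a (x ∷ p) q (suc k) = begin
      coeff (map (a *_) (x ∷ p) *ᴾ q) (suc k)
        ≈⟨ coeff-*-suc (a * x) (map (a *_) p) q k ⟩
      (a * x) * coeff q (suc k) + coeff (map (a *_) p *ᴾ q) k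
        ≈⟨ +-cong (*-assoc _ _ _) (trans (scale-*ᴾ a p q k) (coeff-scale a (p *ᴾ q) k)) ⟩
      a * (x * coeff q (suc k)) + a * coeff (p *ᴾ q) k
        ≈⟨ distribˡ a _ _ ⟨
      a * (x * coeff q (suc k) + coeff (p *ᴾ q) k)
        ≈⟨ *-congˡ (coeff-*-suc x p q k) ⟨
      a * coeff ((x ∷ p) *ᴾ q) (suc k)
        ≈⟨ coeff-scale a ((x ∷ p) *ᴾ q) (suc k) ⟨
      _ ∎

    *ᴾ-assoc : ∀ p q r → ((p *ᴾ q) *ᴾ r) ≋ (p *ᴾ (q *ᴾ r))
    *ᴾ-assoc []      q r k = refl
    *ᴾ-assoc (x ∷ p) q r k = begin
      coeff (((x ∷ p) *ᴾ q) *ᴾ r) k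
        ≈⟨ *ᴾ-distribʳ r (map (x *_) q) (0# ∷ (p *ᴾ q)) k ⟩
      coeff ((map (x *_) q *ᴾ r) +ᴾ ((0# ∷ (p *ᴾ q)) *ᴾ r)) k
        ≈⟨ +ᴾ-cong {map (x *_) q *ᴾ r} {map (x *_) (q *ᴾ r)} {(0# ∷ (p *ᴾ q)) *ᴾ r} {0# ∷ (p *ᴾ (q *ᴾ r))}
             (scale-*ᴾ x q r) shift k ⟩
      coeff (map (x *_) (q *ᴾ r) +ᴾ (0# ∷ (p *ᴾ (q *ᴾ r)))) k ∎
      where
      shift : ((0# ∷ (p *ᴾ q)) *ᴾ r) ≋ (0# ∷ (p *ᴾ (q *ᴾ r)))
      shift zero    = trans (coeff-*-zero 0# (p *ᴾ q) r) (zeroˡ _)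
      shift (suc k) = trans (coeff-*-suc 0# (p *ᴾ q) r k)
        (trans (+-cong (zeroˡ _) (*ᴾ-assoc p q r k)) (+-identityˡ _))

    *ᴾ-identityˡ : ∀ p → ((1# ∷ []) *ᴾ p) ≋ p
    *ᴾ-identityˡ p zero    = trans (coeff-*-zero 1# [] p) (*-identityˡ _)
    *ᴾ-identityˡ p (suc k) = trans (coeff-*-suc 1# [] p k) (trans (+-identityʳ _) (*-identityˡ _))

  polyCommutativeRing : CommutativeRing c ℓ
  polyCommutativeRing = record
    { RawRing polyRing
    ; isCommutativeRing = record
      { isRing = record
        { +-isAbelianGroup = record
          { isGroup = record
            { isMonoid = record
              { isSemigroup = record
                { isMagma = record
                  { isEquivalence = record
                    { refl = λ _ → refl ; sym = λ e k → sym (e k) ; trans = λ e f k → trans (e k) (f k) }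
                  ; ∙-cong = λ {p} {p′} {q} {q′} → +ᴾ-cong {p} {p′} {q} {q′}
                  }
                ; assoc = λ p q r k → trans (coeff-+ (p +ᴾ q) r k) (trans (+-congʳ (coeff-+ p q k))
                    (trans (+-assoc _ _ _) (trans (+-congˡ (sym (coeff-+ q r k))) (sym (coeff-+ p (q +ᴾ r) k)))))
                }
              ; identity = (λ _ _ → refl) , λ p k → trans (coeff-+ p [] k) (+-identityʳ _)
              }
            ; inverse =
                (λ p k → trans (coeff-+ (map -_ p) p k) (trans (+-congʳ (coeff-neg p k)) (-‿inverseˡ _)))
              , (λ p k → trans (coeff-+ p (map -_ p) k) (trans (+-congˡ (coeff-neg p k)) (-‿inverseʳ _)))
            ; ⁻¹-cong = λ {p} {q} e k → trans (coeff-neg p k) (trans (-‿cong (e k)) (sym (coeff-neg q k)))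
            }
          ; comm = λ p q k → trans (coeff-+ p q k) (trans (+-comm _ _) (sym (coeff-+ q p k)))
          }
        ; *-cong = λ {p} {p′} {q} {q′} → *ᴾ-cong {p} {p′} {q} {q′}
        ; *-assoc = *ᴾ-assoc
        ; *-identity = *ᴾ-identityˡ , λ p k → trans (*ᴾ-comm p _ k) (*ᴾ-identityˡ p k)
        ; distrib = *ᴾ-distribˡ , *ᴾ-distribʳ
        }
      ; *-comm = *ᴾ-comm
      }
    }

  private
    module S where
      open CommutativeRing polyCommutativeRing public
      open import Algebra.Definitions.RawSemiring (RawRing.rawSemiring polyRing) public using (_^_)
      open import Relation.Binary.Reasoning.Setoid (CommutativeRing.setoid polyCommutativeRing) public
    module D = Determinant R
    module Dᴾ = Determinant polyCommutativeRing
  open import Algebra.Properties.Ring S.ring using (-‿distribʳ-*; x∙y⁻¹≈ε⇒x≈y)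
  open import Algebra.Properties.Semiring.Sum S.semiring using () renaming (sum to sumᴾ)
  open import Algebra.Properties.Semiring.Sum semiring using (sum)

  -- The degree of p is at most d; it may be smaller, as a may vanish.
  record Lead (p : Poly) (d : ℕ) (a : Carrier) : Set ℓ where
    constructor _,_
    field
      top   : coeff p d ≈ a
      above : ∀ k → d < k → coeff p k ≈ 0#

  lead-cong : ∀ {p q d a b} → p ≋ q → a ≈ b → Lead p d a → Lead q d b
  lead-cong p≋q a≈b (top , above) =
    trans (sym (p≋q _)) (trans top a≈b) , λ k d<k → trans (sym (p≋q k)) (above k d<k)

  lead-suc : ∀ {p d a} → Lead p d a → Lead p (suc d) 0#
  lead-suc (top , above) = above _ ℕₚ.≤-refl , λ k d<k → above k (ℕₚ.<-trans (ℕₚ.n<1+n _) d<k)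

  lead-const : ∀ a → Lead (a ∷ []) 0 a
  lead-const a = refl , λ { (suc k) _ → refl }

  lead-X- : ∀ a → Lead (X- a) 1 1#
  lead-X- a = refl , λ { (suc zero) (s≤s ()) ; (suc (suc k)) _ → refl }

  lead-+ : ∀ {p q d a b} → Lead p d a → Lead q d b → Lead (p +ᴾ q) d (a + b)
  lead-+ {p} {q} (top , above) (top′ , above′) =
    trans (coeff-+ p q _) (+-cong top top′) ,
    λ k d<k → trans (coeff-+ p q k) (trans (+-cong (above k d<k) (above′ k d<k)) (+-identityˡ _))

  -- The top coefficient of the product receives a single contribution, because all other pairs of
  -- degrees adding up to `d + e` exceed one of the two bounds.
  lead-* : ∀ p q {d e a b} → Lead p d a → Lead q e b → Lead (p *ᴾ q) (d ℕ.+ e) (a * b)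
  lead-* [] q (top , _) _ = sym (trans (*-congʳ (sym top)) (zeroˡ _)) , λ _ _ → refl
  lead-* (x ∷ p) q {zero} {e} {a} {b} (top , above) (top′ , above′) =
    trans (constant e) (*-cong top top′) , λ k e<k → trans (constant k) (trans (*-congˡ (above′ k e<k)) (zeroʳ _))
    where
    -- The tail of the first factor vanishes coefficientwise although it need not be the empty list.
    constant : ∀ k → coeff ((x ∷ p) *ᴾ q) k ≈ x * coeff q k
    constant zero    = coeff-*-zero x p q
    constant (suc k) = trans (coeff-*-suc x p q k) (trans
      (+-congˡ (S.*-cong {p} {[]} {q} {q} (λ k → above (suc k) (s≤s z≤n)) (λ _ → refl) k)) (+-identityʳ _))
  lead-* (x ∷ p) q {suc d} {e} (top , above) (top′ , above′) =
    (begin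
      coeff ((x ∷ p) *ᴾ q) (suc (d ℕ.+ e))
        ≈⟨ coeff-*-suc x p q (d ℕ.+ e) ⟩
      x * coeff q (suc (d ℕ.+ e)) + coeff (p *ᴾ q) (d ℕ.+ e)
        ≈⟨ +-cong (trans (*-congˡ (above′ _ (s≤s (ℕₚ.m≤n+m e d)))) (zeroʳ x)) (Lead.top ih) ⟩
      0# + _
        ≈⟨ +-identityˡ _ ⟩
      _ ∎) ,
    λ { (suc k) (s≤s d+e<k) → trans (coeff-*-suc x p q k) (trans
          (+-cong (trans (*-congˡ (above′ (suc k) (s≤s (ℕₚ.≤-trans (ℕₚ.m≤n+m e d) (ℕₚ.<⇒≤ d+e<k)))))
            (zeroʳ x)) (Lead.above ih k d+e<k)) (+-identityˡ _)) }
    where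
    ih = lead-* p q {d} {e} (top , λ k d<k → above (suc k) (s≤s d<k)) (top′ , above′)

  -- Downward induction on a bound for the degree of `q`, starting from its length: if the
  -- coefficients above `n` vanish, the coefficient of the product at `d + n` is exactly that of `q`
  -- at `n`. Only the leading 1 of β enters, so the base ring need not be a domain.
  monic-cancel-zero : ∀ {β d} → Lead β d 1# → ∀ q → (β *ᴾ q) ≋ [] → q ≋ []
  monic-cancel-zero {β} {d} lead q βq≋0 = go (length q) (beyond q)
    where
    go : ∀ n → (∀ k → n ≤ k → coeff q k ≈ 0#) → q ≋ []
    go zero    above k = above k z≤n
    go (suc n) above   = go n λ k n≤k → case (ℕₚ.m≤n⇒m<n∨m≡n n≤k)
      where
      case : ∀ {k} → (n < k) ⊎ (n ≡ k) → coeff q k ≈ 0#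
      case (inj₁ n<k) = above _ n<k
      case (inj₂ ≡.refl) = begin
        coeff q n                ≈⟨ *-identityˡ _ ⟨
        1# * coeff q n           ≈⟨ Lead.top (lead-* β q lead (refl , above)) ⟨
        coeff (β *ᴾ q) (d ℕ.+ n) ≈⟨ βq≋0 _ ⟩
        0#                       ∎
    beyond : ∀ q k → length q ≤ k → coeff q k ≈ 0#
    beyond []      k       _         = refl
    beyond (x ∷ q) (suc k) (s≤s n≤k) = beyond q k n≤k

  monic-cancel : ∀ {β d} → Lead β d 1# → ∀ p q → (β *ᴾ p) ≋ (β *ᴾ q) → p ≋ q
  monic-cancel {β} lead p q βp≋βq = x∙y⁻¹≈ε⇒x≈y p q (monic-cancel-zero lead (p S.- q) (S.begin
    β *ᴾ (p S.- q)               S.≈⟨ S.distribˡ β p (map -_ q) ⟩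
    (β *ᴾ p) +ᴾ (β *ᴾ map -_ q)  S.≈⟨ S.+-cong {β *ᴾ p} {β *ᴾ q} {β *ᴾ map -_ q} {map -_ (β *ᴾ q)} βp≋βq
                                        (S.sym {map -_ (β *ᴾ q)} {β *ᴾ map -_ q} (-‿distribʳ-* β q)) ⟩
    (β *ᴾ q) S.- (β *ᴾ q)        S.≈⟨ S.-‿inverseʳ (β *ᴾ q) ⟩
    []                           S.∎))

  monic-^-cancel : ∀ {β d} → Lead β d 1# → ∀ n p q → ((β S.^ n) *ᴾ p) ≋ ((β S.^ n) *ᴾ q) → p ≋ q
  monic-^-cancel lead zero p q e = S.begin
    p              S.≈⟨ S.*-identityˡ p ⟨
    S.1# *ᴾ p      S.≈⟨ e ⟩
    S.1# *ᴾ q      S.≈⟨ S.*-identityˡ q ⟩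
    q              S.∎
  monic-^-cancel {β} lead (suc n) p q e = monic-^-cancel lead n p q (monic-cancel lead
    ((β S.^ n) *ᴾ p) ((β S.^ n) *ᴾ q) (S.begin
    β *ᴾ ((β S.^ n) *ᴾ p)   S.≈⟨ S.*-assoc β (β S.^ n) p ⟨
    (β S.^ suc n) *ᴾ p      S.≈⟨ e ⟩
    (β S.^ suc n) *ᴾ q      S.≈⟨ S.*-assoc β (β S.^ n) q ⟩
    β *ᴾ ((β S.^ n) *ᴾ q)   S.∎))

  private
    lead-sum : ∀ {n d} (f : Vector Poly n) (a : Vector Carrier n) →
      (∀ i → Lead (f i) d (a i)) → Lead (sumᴾ f) d (sum a)
    lead-sum {zero}  f a lead = refl , λ _ _ → refl
    lead-sum {suc n} f a lead = lead-+ {f zero} (lead zero) (lead-sum (tail f) (tail a) (lead ∘ suc))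

    lead-sgn : ∀ k → Lead (Dᴾ.sgn k) 0 (D.sgn k)
    lead-sgn zero    = lead-const 1#
    lead-sgn (suc k) = lead-* ((- 1#) ∷ []) (Dᴾ.sgn k) (lead-const (- 1#)) (lead-sgn k)

    lead-laplace : ∀ {n} (M : Matrix Poly (suc n)) {d e} j {a b} →
      Lead (M zero j) d a → Lead (det polyRing (Dᴾ.minor M zero j)) e b →
      Lead (Dᴾ.laplace M j) (d ℕ.+ e) ((D.sgn (toℕ j) * a) * b)
    lead-laplace M j lead lead′ = lead-* (Dᴾ.sgn (toℕ j) *ᴾ M zero j) (det polyRing (Dᴾ.minor M zero j))
      (lead-* (Dᴾ.sgn (toℕ j)) (M zero j) (lead-sgn (toℕ j)) lead) lead′

    -- For minors away from the diagonal a degree bound suffices; their top coefficient is left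
    -- unspecified because `det-monic` multiplies it by 0.
    det-degree : ∀ {n} (M : Matrix Poly n) → (∀ i j → ∃ (Lead (M i j) 1)) → ∃ (Lead (det polyRing M) n)
    det-degree {zero}  M lead = 1# , lead-const 1#
    det-degree {suc n} M lead = _ , lead-sum (Dᴾ.laplace M) _ λ j → lead-laplace M j (proj₂ (lead zero j))
      (proj₂ (det-degree (Dᴾ.minor M zero j) λ k l → lead (suc k) (punchIn j l)))

  -- Only the corner term of the expansion reaches degree `n`: every other term has a first factor
  -- whose coefficient at X is 0.
  det-monic : ∀ {n} (M : Matrix Poly n) → (∀ i → Lead (M i i) 1 1#) →
    (∀ i j → i ≢ j → Lead (M i j) 1 0#) → Lead (det polyRing M) n 1#
  det-monic {zero}  M diag off = lead-const 1#
  det-monic {suc n} M diag off = lead-cong {det polyRing M} {det polyRing M} (λ _ → refl) top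
    (lead-sum (Dᴾ.laplace M) tops lead)
    where
    entry-degree : ∀ i j → ∃ (Lead (M i j) 1)
    entry-degree i j with i ≟ j
    ... | yes ≡.refl = 1# , diag i
    ... | no i≢j     = 0# , off i j i≢j
    minor-degree : ∀ j → ∃ (Lead (det polyRing (Dᴾ.minor M zero j)) n)
    minor-degree j = det-degree (Dᴾ.minor M zero j) λ k l → entry-degree (suc k) (punchIn j l)
    tops : Vector Carrier (suc n)
    tops zero    = (1# * 1#) * 1#
    tops (suc j) = (D.sgn (suc (toℕ j)) * 0#) * proj₁ (minor-degree (suc j))
    lead : ∀ j → Lead (Dᴾ.laplace M j) (suc n) (tops j)
    lead zero    = lead-laplace M zero (diag zero) (det-monic (Dᴾ.minor M zero zero) (diag ∘ suc)
      λ i j i≢j → off (suc i) (suc j) (i≢j ∘ suc-injective))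
    lead (suc j) = lead-laplace M (suc j) (off zero (suc j) λ ()) (proj₂ (minor-degree (suc j)))
    top : sum tops ≈ 1#
    top = begin
      (1# * 1#) * 1# + sum (tail tops)
        ≈⟨ +-cong (trans (*-identityʳ _) (*-identityʳ _))
             (D.sum-zero {f = tail tops} λ j → trans (*-congʳ (zeroʳ _)) (zeroˡ _)) ⟩
      1# + 0#
        ≈⟨ +-identityʳ 1# ⟩
      1# ∎

-- Ring homomorphisms and evaluation of polynomials

det-homo : ∀ {c ℓ c′ ℓ′} (R : RawRing c ℓ) (S : CommutativeRing c′ ℓ′) →
  let module S = CommutativeRing S in {φ : RawRing.Carrier R → S.Carrier} →
  IsRingHomomorphism R S.rawRing φ → ∀ {n} (M : Matrix (RawRing.Carrier R) n) →
  φ (det R M) S.≈ det S.rawRing (λ i j → φ (M i j))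
det-homo R S {φ} homo {zero}  M = 1#-homo
  where open IsRingHomomorphism homo
det-homo R S {φ} homo {suc n} M = S.trans (sum-homo λ j → (sgn (toℕ j) *ᴿ M zero j) *ᴿ det R (λ k l → M (suc k) (punchIn j l)))
  (sum-cong-≋ {y = Determinant.laplace S λ i j → φ (M i j)} λ j → S.trans (*-homo _ _)
    (S.*-cong (S.trans (*-homo _ _) (S.*-congʳ (sgn-homo (toℕ j))))
      (det-homo R S homo λ k l → M (suc k) (punchIn j l))))
  where
  module S = CommutativeRing S
  open IsRingHomomorphism homo
  open RawRing R using (rawSemiring; +-rawMonoid) renaming (_*_ to _*ᴿ_; -_ to -ᴿ_; 1# to 1ᴿ)
  open import Algebra.Definitions.RawMonoid +-rawMonoid using () renaming (sum to sumᴿ)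
  open import Algebra.Definitions.RawSemiring rawSemiring using () renaming (_^_ to _^ᴿ_)
  open import Algebra.Properties.Semiring.Sum S.semiring using (sum; sum-cong-≋)
  sgn : ℕ → RawRing.Carrier R
  sgn k = (-ᴿ 1ᴿ) ^ᴿ k
  sum-homo : ∀ {n} (f : Vector (RawRing.Carrier R) n) → φ (sumᴿ f) S.≈ sum (φ ∘ f)
  sum-homo {zero}  f = 0#-homo
  sum-homo {suc n} f = S.trans (+-homo _ _) (S.+-congˡ (sum-homo (tail f)))
  sgn-homo : ∀ k → φ (sgn k) S.≈ Determinant.sgn S k
  sgn-homo zero    = 1#-homo
  sgn-homo (suc k) = S.trans (*-homo _ _)
    (S.*-cong (S.trans (-‿homo _) (S.-‿cong 1#-homo)) (sgn-homo k))

module Evaluation {c ℓ c′ ℓ′} (R : CommutativeRing c ℓ) (S : CommutativeRing c′ ℓ′)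
  {ι : CommutativeRing.Carrier R → CommutativeRing.Carrier S}
  (ι-homo : IsRingHomomorphism (CommutativeRing.rawRing R) (CommutativeRing.rawRing S) ι)
  (y : CommutativeRing.Carrier S) where

  private
    module R = CommutativeRing R
    module ι = IsRingHomomorphism ι-homo
  open PolynomialRing R using (Poly; _≋_; polyRing; _+ᴾ_; _*ᴾ_)
  open CommutativeRing S hiding (zero)
  open import Algebra.Properties.Ring ring using (-0#≈0#; -‿distribʳ-*; -‿+-comm)
  open import Algebra.Solver.Ring.NaturalCoefficients.Default commutativeSemiring
    using (solve; _:=_; _:+_; _:*_)
  open import Relation.Binary.Reasoning.Setoid setoid

  -- Values are taken in an arbitrary commutative ring under `R`. With `S` equal to `R` this gives
  -- roots; with `S` the polynomial ring it is substitution of one polynomial into another.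
  ⟦_⟧ : Poly → Carrier
  ⟦ [] ⟧    = 0#
  ⟦ x ∷ p ⟧ = ι x + y * ⟦ p ⟧

  private
    ∷-zero : ∀ {x e} → x R.≈ R.0# → e ≈ 0# → ι x + y * e ≈ 0#
    ∷-zero x≈0 e≈0 = trans (+-cong (trans (ι.⟦⟧-cong x≈0) ι.0#-homo) (trans (*-congˡ e≈0) (zeroʳ y)))
      (+-identityˡ 0#)

    ⟦⟧-zero : ∀ p → p ≋ [] → ⟦ p ⟧ ≈ 0#
    ⟦⟧-zero []      p≋0 = refl
    ⟦⟧-zero (x ∷ p) p≋0 = ∷-zero (p≋0 0) (⟦⟧-zero p (p≋0 ∘ suc))

    ⟦⟧-cong : ∀ p q → p ≋ q → ⟦ p ⟧ ≈ ⟦ q ⟧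
    ⟦⟧-cong []      q       p≋q = sym (⟦⟧-zero q (R.sym ∘ p≋q))
    ⟦⟧-cong (x ∷ p) []      p≋q = ⟦⟧-zero (x ∷ p) p≋q
    ⟦⟧-cong (x ∷ p) (z ∷ q) p≋q = +-cong (ι.⟦⟧-cong (p≋q 0)) (*-congˡ (⟦⟧-cong p q (p≋q ∘ suc)))

    ⟦⟧-+ : ∀ p q → ⟦ p +ᴾ q ⟧ ≈ ⟦ p ⟧ + ⟦ q ⟧
    ⟦⟧-+ []      q       = sym (+-identityˡ _)
    ⟦⟧-+ (x ∷ p) []      = sym (+-identityʳ _)
    ⟦⟧-+ (x ∷ p) (z ∷ q) = trans (+-cong (ι.+-homo x z) (*-congˡ (⟦⟧-+ p q)))
      (solve 5 (λ x z y p q → (x :+ z) :+ y :* (p :+ q) := (x :+ y :* p) :+ (z :+ y :* q))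
        refl (ι x) (ι z) y ⟦ p ⟧ ⟦ q ⟧)

    ⟦⟧-scale : ∀ a p → ⟦ map (a R.*_) p ⟧ ≈ ι a * ⟦ p ⟧
    ⟦⟧-scale a []      = sym (zeroʳ _)
    ⟦⟧-scale a (x ∷ p) = trans (+-cong (ι.*-homo a x) (*-congˡ (⟦⟧-scale a p)))
      (solve 4 (λ a x y p → a :* x :+ y :* (a :* p) := a :* (x :+ y :* p)) refl (ι a) (ι x) y ⟦ p ⟧)

    ⟦⟧-* : ∀ p q → ⟦ p *ᴾ q ⟧ ≈ ⟦ p ⟧ * ⟦ q ⟧
    ⟦⟧-* []      q = sym (zeroˡ _)
    ⟦⟧-* (x ∷ p) q = begin
      ⟦ map (x R.*_) q +ᴾ (R.0# ∷ (p *ᴾ q)) ⟧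
        ≈⟨ ⟦⟧-+ (map (x R.*_) q) _ ⟩
      ⟦ map (x R.*_) q ⟧ + (ι R.0# + y * ⟦ p *ᴾ q ⟧)
        ≈⟨ +-cong (⟦⟧-scale x q) (trans (+-congʳ ι.0#-homo) (trans (+-identityˡ _) (*-congˡ (⟦⟧-* p q)))) ⟩
      ι x * ⟦ q ⟧ + y * (⟦ p ⟧ * ⟦ q ⟧)
        ≈⟨ solve 4 (λ x y p q → x :* q :+ y :* (p :* q) := (x :+ y :* p) :* q) refl (ι x) y ⟦ p ⟧ ⟦ q ⟧ ⟩
      (ι x + y * ⟦ p ⟧) * ⟦ q ⟧ ∎

    ⟦⟧-neg : ∀ p → ⟦ map R.-_ p ⟧ ≈ - ⟦ p ⟧
    ⟦⟧-neg []      = sym -0#≈0#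
    ⟦⟧-neg (x ∷ p) = begin
      ι (R.- x) + y * ⟦ map R.-_ p ⟧  ≈⟨ +-cong (ι.-‿homo x) (*-congˡ (⟦⟧-neg p)) ⟩
      - ι x + y * - ⟦ p ⟧             ≈⟨ +-congˡ (-‿distribʳ-* y ⟦ p ⟧) ⟨
      - ι x + - (y * ⟦ p ⟧)           ≈⟨ -‿+-comm (ι x) (y * ⟦ p ⟧) ⟩
      - (ι x + y * ⟦ p ⟧)             ∎

  ⟦⟧-const : ∀ a → ⟦ a ∷ [] ⟧ ≈ ι a
  ⟦⟧-const a = trans (+-congˡ (zeroʳ y)) (+-identityʳ _)

  ⟦⟧-homo : IsRingHomomorphism polyRing rawRing ⟦_⟧
  ⟦⟧-homo = record
    { isSemiringHomomorphism = record
      { isNearSemiringHomomorphism = record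
        { +-isMonoidHomomorphism = record
          { isMagmaHomomorphism = record
            { isRelHomomorphism = record { cong = λ {p} {q} → ⟦⟧-cong p q }
            ; homo = ⟦⟧-+
            }
          ; ε-homo = refl
          }
        ; *-homo = ⟦⟧-*
        }
      ; 1#-homo = trans (⟦⟧-const R.1#) ι.1#-homo
      }
    ; -‿homo = ⟦⟧-neg
    }

-- Linear factors and spectra over an algebraically closed field

module Splitting {c ℓ₁ ℓ₂} (K : AlgebraicallyClosedField₀ c ℓ₁ ℓ₂) where
  open AlgebraicallyClosedField₀ K
    using (commutativeRing; characteristicZero; algebraicallyClosed)
  open CommutativeRing commutativeRing hiding (zero)
  open PolynomialRing commutativeRing
  open import Algebra.Properties.Semiring.Sum semiring using (sum; sum-cong-≋; *-distribˡ-sum)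
  open import Algebra.Definitions.RawSemiring (RawRing.rawSemiring rawRing) using (_^_)
  open import Algebra.Solver.Ring.NaturalCoefficients.Default commutativeSemiring
    using (solve; _:=_; _:+_; _:*_)
  open import Relation.Binary.Reasoning.Setoid setoid
  open Evaluation commutativeRing commutativeRing (isRingHomomorphism rawRing refl)
    using () renaming (⟦_⟧ to evaluate)

  monic : ∀ {n} → Vector Carrier n → Poly
  monic {zero}  a = 1# ∷ []
  monic {suc n} a = a zero ∷ monic (tail a)

  -- Translates Horner evaluation into the sum of powers in which algebraic closedness is stated.
  eval-monic : ∀ {n} (a : Vector Carrier n) x →
    evaluate x (monic a) ≈ x ^ n + sum (λ i → a i * x ^ toℕ i)
  eval-monic {zero}  a x = +-congˡ (zeroʳ x)
  eval-monic {suc n} a x = begin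
    a zero + x * evaluate x (monic (tail a))
      ≈⟨ +-congˡ (*-congˡ (eval-monic (tail a) x)) ⟩
    a zero + x * (x ^ n + sum (λ i → a (suc i) * x ^ toℕ i))
      ≈⟨ +-congˡ (trans (distribˡ x _ _) (+-congˡ (trans
           (*-distribˡ-sum x λ i → a (suc i) * x ^ toℕ i)
           (sum-cong-≋ λ i → solve 3 (λ x a y → x :* (a :* y) := a :* (x :* y)) refl x (a (suc i)) (x ^ toℕ i))))) ⟩
    a zero + (x ^ suc n + sum (λ i → a (suc i) * x ^ suc (toℕ i)))
      ≈⟨ solve 3 (λ a b c → a :+ (b :+ c) := b :+ (a :+ c)) refl _ _ _ ⟩
    x ^ suc n + (a zero + sum (λ i → a (suc i) * x ^ suc (toℕ i)))
      ≈⟨ +-congˡ (+-congʳ (*-identityʳ _)) ⟨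
    x ^ suc n + (a zero * 1# + sum (λ i → a (suc i) * x ^ suc (toℕ i))) ∎

  -- Horner's scheme: the partial values are the coefficients of the quotient by X - x.
  quotient : ∀ {n} → Vector Carrier (suc n) → Carrier → Vector Carrier n
  quotient {zero}  a x = ⟨⟩
  quotient {suc n} a x = evaluate x (monic (tail a)) ◂ quotient (tail a) x

  private
    coeff-X-*-zero : ∀ x p → coeff ((X- x) *ᴾ p) 0 ≈ - x * coeff p 0
    coeff-X-*-zero x p = coeff-*-zero (- x) (1# ∷ []) p

    coeff-X-*-suc : ∀ x p k → coeff ((X- x) *ᴾ p) (suc k) ≈ - x * coeff p (suc k) + coeff p k
    coeff-X-*-suc x p k = trans (coeff-*-suc (- x) (1# ∷ []) p k)
      (+-congˡ (CommutativeRing.*-identityˡ polyCommutativeRing p k))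

    cancel : ∀ a x e → - x * e + (a + x * e) ≈ a
    cancel a x e = begin
      - x * e + (a + x * e)    ≈⟨ solve 4 (λ y x a e → y :* e :+ (a :+ x :* e) := a :+ (y :+ x) :* e)
                                    refl (- x) x a e ⟩
      a + (- x + x) * e        ≈⟨ +-congˡ (trans (*-congʳ (-‿inverseˡ x)) (zeroˡ e)) ⟩
      a + 0#                   ≈⟨ +-identityʳ a ⟩
      a                        ∎

    -- Division by X - x with remainder the value at x, compared coefficient by coefficient; only
    -- the constant coefficient sees the remainder.
    division-zero : ∀ {n} (a : Vector Carrier (suc n)) x →
      coeff (monic a) 0 ≈ - x * coeff (monic (quotient a x)) 0 + evaluate x (monic a)
    division-zero {zero}  a x = sym (trans (+-congˡ (+-congˡ (*-congˡ (trans (+-congˡ (zeroʳ x)) (+-identityʳ _)))))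
      (cancel (a zero) x 1#))
    division-zero {suc n} a x = sym (cancel (a zero) x _)

    division-suc : ∀ {n} (a : Vector Carrier (suc n)) x k → coeff (monic a) (suc k) ≈
      - x * coeff (monic (quotient a x)) (suc k) + coeff (monic (quotient a x)) k
    division-suc {zero}  a x zero    = sym (trans (+-congʳ (zeroʳ _)) (+-identityˡ _))
    division-suc {zero}  a x (suc k) = sym (trans (+-congʳ (zeroʳ _)) (+-identityˡ _))
    -- The remainder of dividing `tail a` is the first coefficient of the quotient of `a`, so this
    -- is the constant coefficient of the shorter division.
    division-suc {suc n} a x zero    = division-zero (tail a) x
    division-suc {suc n} a x (suc k) = division-suc (tail a) x k

  X-_divides-monic : ∀ {n} x (a : Vector Carrier (suc n)) → evaluate x (monic a) ≈ 0# →
    monic a ≋ ((X- x) *ᴾ monic (quotient a x))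
  X- x divides-monic a root zero = trans (division-zero a x)
    (trans (+-congˡ root) (trans (+-identityʳ _) (sym (coeff-X-*-zero x (monic (quotient a x))))))
  X- x divides-monic a root (suc k) = trans (division-suc a x k)
    (sym (coeff-X-*-suc x (monic (quotient a x)) k))

  monic-splits : ∀ {n} (a : Vector Carrier n) →
    ∃ λ xs → monic a ≋ foldr (λ x p → (X- x) *ᴾ p) (1# ∷ []) xs
  monic-splits {zero}  a = [] , λ _ → refl
  monic-splits {suc n} a =
    let x , root = algebraicallyClosed n a
        xs , e   = monic-splits (quotient a x)
        roots    = foldr (λ x p → (X- x) *ᴾ p) (1# ∷ []) xs
    in x ∷ xs , λ k → trans (X- x divides-monic a (trans (eval-monic a x) root) k)
         (CommutativeRing.*-cong polyCommutativeRing {X- x} {X- x} {monic (quotient a x)} {roots}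
           (λ _ → refl) e k)

  private
    -- A determinant is a list that may have trailing zeros and a leading coefficient only
    -- equivalent to 1. Reading off its lower coefficients puts it into the normal form that can be
    -- split.
    coeff-monic : ∀ n (f : ℕ → Carrier) → f n ≈ 1# → (∀ k → n < k → f k ≈ 0#) →
      ∀ k → coeff (monic {n} (f ∘ toℕ)) k ≈ f k
    coeff-monic zero    f top above zero    = sym top
    coeff-monic zero    f top above (suc k) = sym (above (suc k) (s≤s z≤n))
    coeff-monic (suc n) f top above zero    = refl
    coeff-monic (suc n) f top above (suc k) =
      coeff-monic n (f ∘ suc) top (λ k n<k → above (suc k) (s≤s n<k)) k

  charpoly-monic : ∀ {n} (M : Matrix Carrier n) → Lead (charpoly M) n 1#
  charpoly-monic M = det-monic _ diagonal off
    where
    entry : ∀ i j → Poly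
    entry i j = if ⌊ i ≟ j ⌋ then X- (M i j) else (- (M i j)) ∷ []
    diagonal : ∀ i → Lead (entry i i) 1 1#
    diagonal i with i ≟ i
    ... | yes _  = lead-X- (M i i)
    ... | no i≢i = contradiction ≡.refl i≢i
    off : ∀ i j → i ≢ j → Lead (entry i j) 1 0#
    off i j i≢j with i ≟ j
    ... | yes i≡j = contradiction i≡j i≢j
    ... | no _    = lead-suc (lead-const (- (M i j)))

  spectrum-exists : ∀ {n} (M : Matrix Carrier n) → ∃ (HasSpectrum M)
  spectrum-exists {n} M =
    let xs , e = monic-splits {n} (coeff (charpoly M) ∘ toℕ)
    in xs , λ k → trans (sym (coeff-monic n (coeff (charpoly M)) top above k)) (e k)
    where open Lead (charpoly-monic M)

  1≉0 : ¬ 1# ≈ 0#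
  1≉0 1≈0 = characteristicZero 0 (trans (+-identityʳ 1#) 1≈0)

  -- For characteristic polynomials this gives cospectral graphs the same order.
  monic-degree-unique : ∀ {p q d e} → p ≋ q → Lead p d 1# → Lead q e 1# → d ≡ e
  monic-degree-unique {d = d} {e} p≋q (top , above) (top′ , above′) with ℕₚ.<-cmp d e
  ... | tri< d<e _ _ = contradiction (trans (sym top′) (trans (sym (p≋q e)) (above e d<e))) 1≉0
  ... | tri≈ _ d≡e _ = d≡e
  ... | tri> _ _ e<d = contradiction (trans (sym top) (trans (p≋q d) (above′ d e<d))) 1≉0

-- Characteristic polynomials of splitting joins

-- Both splitting joins are instances by definition: `N` is the adjacency of G or the non-adjacency
-- of distinct vertices. The spectral computation treats all `N` at once.
attach : (G F : Graph) → (Fin (order G) → Fin (order G) → Bool) → Graph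
attach G F N = addVertices (G ∨ F) (order G) λ i → [ N i , const false ]′ ∘ splitAt (order G)

Vertex : ℕ → ℕ → Set
Vertex n m = (Fin n ⊎ Fin m) ⊎ Fin n

-- Base vertices are those of G, fibre vertices those of the regular graph, and `copy i` is the new
-- vertex belonging to `base i`.
pattern base i  = inj₁ (inj₁ i)
pattern fibre f = inj₁ (inj₂ f)
pattern copy i  = inj₂ i

index : ∀ {n m} → Vertex n m → Fin (n ℕ.+ m ℕ.+ n)
index {n} {m} v = join (n ℕ.+ m) n (Sum.map₁ (join n m) v)

vertex : ∀ {n m} → Fin (n ℕ.+ m ℕ.+ n) → Vertex n m
vertex {n} {m} x = Sum.map₁ (splitAt n) (splitAt (n ℕ.+ m) x)

vertex-index : ∀ {n m} (v : Vertex n m) → vertex (index v) ≡ v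
vertex-index {n} {m} v rewrite splitAt-join (n ℕ.+ m) n (Sum.map₁ (join n m) v) with v
... | inj₁ a = ≡.cong inj₁ (splitAt-join n m a)
... | inj₂ k = ≡.refl

index-vertex : ∀ {n m} (x : Fin (n ℕ.+ m ℕ.+ n)) → index {n} {m} (vertex x) ≡ x
index-vertex {n} {m} x = ≡.trans (≡.cong (join (n ℕ.+ m) n) (rejoin (splitAt (n ℕ.+ m) x))) (join-splitAt (n ℕ.+ m) n x)
  where
  rejoin : ∀ s → Sum.map₁ (join n m) (Sum.map₁ (splitAt n) s) ≡ s
  rejoin (inj₁ y) = ≡.cong inj₁ (join-splitAt n m y)
  rejoin (inj₂ k) = ≡.refl

count : ∀ {n} → (Fin n → Bool) → ℕ
count h = Subset.∣ tabulate h ∣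

count-cong : ∀ {n} {h h′ : Fin n → Bool} → (∀ i → h i ≡ h′ i) → count h ≡ count h′
count-cong h≗h′ = ≡.cong Subset.∣_∣ (tabulate-cong h≗h′)

count-++ : ∀ m {n} (h : Fin (m ℕ.+ n) → Bool) →
  count h ≡ count (h ∘ (_↑ˡ n)) ℕ.+ count (h ∘ (m ↑ʳ_))
count-++ zero    h = ≡.refl
count-++ (suc m) h with h zero
... | true  = ≡.cong suc (count-++ m (h ∘ suc))
... | false = count-++ m (h ∘ suc)

module Attached (G F : Graph) (N : Fin (order G) → Fin (order G) → Bool) where
  private
    n = order G
    m = order F

  edge : (v w : Vertex n m) → Bool
  edge (base i)  (base j)  = adj G i j
  edge (base i)  (fibre g) = true
  edge (base i)  (copy l)  = N l i
  edge (fibre f) (base j)  = true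
  edge (fibre f) (fibre g) = adj F f g
  edge (fibre f) (copy l)  = false
  edge (copy k)  (base j)  = N k j
  edge (copy k)  (fibre g) = false
  edge (copy k)  (copy l)  = false

  adj-index : ∀ v w → adj (attach G F N) (index v) (index w) ≡ edge v w
  adj-index v w rewrite splitAt-join (n ℕ.+ m) n (Sum.map₁ (join n m) v)
                      | splitAt-join (n ℕ.+ m) n (Sum.map₁ (join n m) w) with v | w
  ... | base i  | base j  rewrite splitAt-↑ˡ n i m | splitAt-↑ˡ n j m = ≡.refl
  ... | base i  | fibre g rewrite splitAt-↑ˡ n i m | splitAt-↑ʳ n m g = ≡.refl
  ... | base i  | copy l  rewrite splitAt-↑ˡ n i m = ≡.refl
  ... | fibre f | base j  rewrite splitAt-↑ʳ n m f | splitAt-↑ˡ n j m = ≡.refl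
  ... | fibre f | fibre g rewrite splitAt-↑ʳ n m f | splitAt-↑ʳ n m g = ≡.refl
  ... | fibre f | copy l  rewrite splitAt-↑ʳ n m f = ≡.refl
  ... | copy k  | base j  rewrite splitAt-↑ˡ n j m = ≡.refl
  ... | copy k  | fibre g rewrite splitAt-↑ʳ n m g = ≡.refl
  ... | copy k  | copy l  = ≡.refl

  degree-index : ∀ v → degree (attach G F N) (index v) ≡
    count (edge v ∘ λ i → base i) ℕ.+ count (edge v ∘ λ f → fibre f) ℕ.+ count (edge v ∘ λ i → copy i)
  degree-index v = begin
    count h
      ≡⟨ count-++ (n ℕ.+ m) h ⟩
    count (h ∘ (_↑ˡ n)) ℕ.+ count (h ∘ ((n ℕ.+ m) ↑ʳ_))
      ≡⟨ ≡.cong (ℕ._+ count (h ∘ ((n ℕ.+ m) ↑ʳ_))) (count-++ n (h ∘ (_↑ˡ n))) ⟩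
    count (h ∘ ix ∘ λ i → base i) ℕ.+ count (h ∘ ix ∘ λ f → fibre f) ℕ.+ count (h ∘ ix ∘ λ i → copy i)
      ≡⟨ ≡.cong₂ ℕ._+_ (≡.cong₂ ℕ._+_ (count-cong λ i → adj-index v (base i)) (count-cong λ f → adj-index v (fibre f)))
           (count-cong λ i → adj-index v (copy i)) ⟩
    _ ∎
    where
    open ≡-Reasoning
    ix : Vertex n m → Fin (n ℕ.+ m ℕ.+ n)
    ix = index
    h : Fin (n ℕ.+ m ℕ.+ n) → Bool
    h = adj (attach G F N) (index v)

  outer : Fin (n ℕ.+ n) → Vertex n m
  outer = [ (λ i → base i) , (λ i → copy i) ]′ ∘ splitAt n

  -- The join numbers G first, whereas clearing the border needs the regular graph as the top left
  -- block.
  reorder : Permutation (m ℕ.+ (n ℕ.+ n)) (n ℕ.+ m ℕ.+ n)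
  reorder = permutation (index ∘ from) (to ∘ vertex) index-to to-index
    where
    from : Fin (m ℕ.+ (n ℕ.+ n)) → Vertex n m
    from = [ (λ f → fibre f) , outer ]′ ∘ splitAt m
    to : Vertex n m → Fin (m ℕ.+ (n ℕ.+ n))
    to (fibre f) = f ↑ˡ (n ℕ.+ n)
    to (base i)  = m ↑ʳ (i ↑ˡ n)
    to (copy i)  = m ↑ʳ (n ↑ʳ i)
    from-to : ∀ v → from (to v) ≡ v
    from-to (fibre f) rewrite splitAt-↑ˡ m f (n ℕ.+ n) = ≡.refl
    from-to (base i) rewrite splitAt-↑ʳ m (n ℕ.+ n) (i ↑ˡ n) | splitAt-↑ˡ n i n = ≡.refl
    from-to (copy i) rewrite splitAt-↑ʳ m (n ℕ.+ n) (n ↑ʳ i) | splitAt-↑ʳ n n i = ≡.refl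
    to-from : ∀ x → to (from x) ≡ x
    to-from x with splitAt m x in e
    ... | inj₁ f = splitAt⁻¹-↑ˡ e
    ... | inj₂ y with splitAt n y in e′
    ...   | inj₁ i = ≡.trans (≡.cong (m ↑ʳ_) (splitAt⁻¹-↑ˡ e′)) (splitAt⁻¹-↑ʳ e)
    ...   | inj₂ i = ≡.trans (≡.cong (m ↑ʳ_) (splitAt⁻¹-↑ʳ e′)) (splitAt⁻¹-↑ʳ e)
    index-to : ∀ y → index {n} {m} (from (to (vertex y))) ≡ y
    index-to y = ≡.trans (≡.cong index (from-to (vertex y))) (index-vertex {n} {m} y)
    to-index : ∀ x → to (vertex (index (from x))) ≡ x
    to-index x = ≡.trans (≡.cong to (vertex-index (from x))) (to-from x)

  reorder-↑ˡ : ∀ f → reorder ⟨$⟩ʳ (f ↑ˡ (n ℕ.+ n)) ≡ index {n} {m} (fibre f)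
  reorder-↑ˡ f rewrite splitAt-↑ˡ m f (n ℕ.+ n) = ≡.refl

  reorder-↑ʳ : ∀ i → reorder ⟨$⟩ʳ (m ↑ʳ i) ≡ index (outer i)
  reorder-↑ʳ i rewrite splitAt-↑ʳ m (n ℕ.+ n) i = ≡.refl

⌊≟⌋-injective : ∀ {m n} (f : Fin m → Fin n) → (∀ {i j} → f i ≡ f j → i ≡ j) →
  ∀ i j → ⌊ f i ≟ f j ⌋ ≡ ⌊ i ≟ j ⌋
⌊≟⌋-injective f inj i j with i ≟ j | f i ≟ f j
... | yes _   | yes _     = ≡.refl
... | no _    | no _      = ≡.refl
... | yes i≡j | no fi≢fj  = contradiction (≡.cong f i≡j) fi≢fj
... | no i≢j  | yes fi≡fj = contradiction (inj fi≡fj) i≢j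

⌊≟⌋-distinct : ∀ {n} {i j : Fin n} → i ≢ j → ⌊ i ≟ j ⌋ ≡ false
⌊≟⌋-distinct {i = i} {j} i≢j with i ≟ j
... | yes i≡j = contradiction i≡j i≢j
... | no _    = ≡.refl

index-injective : ∀ {n m} {v w : Vertex n m} → index v ≡ index w → v ≡ w
index-injective {v = v} {w} e = ≡.trans (≡.sym (vertex-index v)) (≡.trans (≡.cong vertex e) (vertex-index w))

module CharacteristicMatrix {c ℓ c′ ℓ′} (R : CommutativeRing c ℓ) (S : CommutativeRing c′ ℓ′)
  {ι : CommutativeRing.Carrier R → CommutativeRing.Carrier S}
  (ι-homo : IsRingHomomorphism (CommutativeRing.rawRing R) (CommutativeRing.rawRing S) ι)
  (x : CommutativeRing.Carrier S) where

  private
    module R where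
      open CommutativeRing R public
      open RawMonoidDefs (RawRing.+-rawMonoid rawRing) public using () renaming (_×_ to _·_)
    module ι = IsRingHomomorphism ι-homo
  open CommutativeRing S hiding (zero)
  open import Algebra.Properties.Ring ring using (-0#≈0#; -‿distribʳ-*; -‿+-comm)
  open import Algebra.Properties.Ring R.ring using () renaming (-‿distribˡ-* to R-‿distribˡ-*; -‿involutive to R-‿involutive)
  open import Algebra.Properties.Semiring.Sum semiring using (sum; sum-cong-≋; ∑-distrib-+)
  open import Algebra.Properties.Semiring.Sum R.semiring using () renaming (sum to sumᴿ; sum-cong-≋ to sumᴿ-cong)
  open import Algebra.Definitions.RawSemiring (RawRing.rawSemiring rawRing) using (_^_)
  open import Relation.Binary.Reasoning.Setoid setoid
  open Determinant S using (det-cong; det-permute; det-scale; det-bordered; sum-zero)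
  open PolynomialRing R using (Poly; _≋_; charpoly)
  open Evaluation R S ι-homo using (⟦_⟧; ⟦⟧-homo; ⟦⟧-const)

  char : ∀ {n} → Matrix R.Carrier n → Matrix Carrier n
  char M i j = (if ⌊ i ≟ j ⌋ then x else 0#) + - ι (M i j)

  -- With `sign`, this gives the three matrices a common form, a diagonal matrix plus a signed
  -- adjacency matrix, so that a single computation serves A, L and Q.
  diagonal : MatrixType → ℕ → R.Carrier
  diagonal A d = R.0#
  diagonal L d = d R.· R.1#
  diagonal Q d = d R.· R.1#

  sign : MatrixType → R.Carrier
  sign A = R.1#
  sign L = R.- R.1#
  sign Q = R.1#

  𝟙 : Bool → R.Carrier
  𝟙 b = if b then R.1# else R.0#

  sign² : ∀ X → sign X R.* sign X R.≈ R.1#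
  sign² A = R.*-identityˡ _
  sign² L = R.trans (R.sym (R-‿distribˡ-* _ _)) (R.trans (R.-‿cong (R.*-identityˡ _)) (R-‿involutive _))
  sign² Q = R.*-identityˡ _

  matrix-entry : ∀ X G i j → matrix R.rawRing X G i j R.≈
    (if ⌊ i ≟ j ⌋ then diagonal X (degree G i) else R.0#) R.+ sign X R.* 𝟙 (adj G i j)
  matrix-entry A G i j with ⌊ i ≟ j ⌋
  ... | true  = R.sym (R.trans (R.+-identityˡ _) (R.*-identityˡ _))
  ... | false = R.sym (R.trans (R.+-identityˡ _) (R.*-identityˡ _))
  matrix-entry L G i j = R.+-congˡ (R.trans (R.-‿cong (R.sym (R.*-identityˡ _))) (R-‿distribˡ-* _ _))
  matrix-entry Q G i j = R.+-congˡ (R.sym (R.*-identityˡ _))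

  sum-𝟙 : ∀ {n} (h : Fin n → Bool) → sumᴿ (𝟙 ∘ h) R.≈ count h R.· R.1#
  sum-𝟙 {zero}  h = R.refl
  sum-𝟙 {suc n} h with h zero
  ... | true  = R.+-congˡ (sum-𝟙 (h ∘ suc))
  ... | false = R.trans (R.+-identityˡ _) (sum-𝟙 (h ∘ suc))

  sum-diagonal : ∀ {n} (f : Fin n) y → sum (λ g → if ⌊ g ≟ f ⌋ then y else 0#) ≈ y
  sum-diagonal {suc n} zero y = trans (+-congˡ (sum-zero {n} {λ g → if ⌊ suc g ≟ zero ⌋ then y else 0#} λ _ → refl)) (+-identityʳ y)
  sum-diagonal (suc f) y = trans (+-identityˡ _) (trans
    (sum-cong-≋ λ g → reflexive (≡.cong (if_then y else 0#) (⌊≟⌋-injective suc suc-injective g f)))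
    (sum-diagonal f y))

  module _ (X : MatrixType) where
    private s = sign X

    -- An entry of the characteristic matrix as a function of the diagonal value, of coincidence and
    -- of adjacency. Blocks of different graphs then become comparable without reference to their
    -- vertices.
    entry : R.Carrier → Bool → Bool → Carrier
    entry d same joined = (if same then x + - ι d else 0#) + - ι (s R.* 𝟙 joined)

    char-entry : ∀ G i j → char (matrix R.rawRing X G) i j ≈
      entry (diagonal X (degree G i)) ⌊ i ≟ j ⌋ (adj G i j)
    char-entry G i j = trans
      (+-congˡ (-‿cong (trans (ι.⟦⟧-cong (matrix-entry X G i j)) (ι.+-homo _ _)))) (split ⌊ i ≟ j ⌋)
      where
      d = diagonal X (degree G i)
      t = ι (s R.* 𝟙 (adj G i j))
      split : ∀ b → (if b then x else 0#) + - (ι (if b then d else R.0#) + t) ≈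
        (if b then x + - ι d else 0#) + - t
      split true  = trans (+-congˡ (sym (-‿+-comm (ι d) t))) (sym (+-assoc x (- ι d) (- t)))
      split false = +-congˡ (-‿cong (trans (+-congʳ ι.0#-homo) (+-identityˡ t)))

    sum-weights : ∀ {n} (h : Fin n → R.Carrier) → sum (λ g → - ι (s R.* h g)) ≈ - ι (s R.* sumᴿ h)
    sum-weights {zero}  h = sym (trans (-‿cong (trans (ι.⟦⟧-cong (R.zeroʳ _)) ι.0#-homo)) -0#≈0#)
    sum-weights {suc n} h = begin
      - ι (s R.* h zero) + sum (λ g → - ι (s R.* h (suc g)))
        ≈⟨ +-congˡ (sum-weights (h ∘ suc)) ⟩
      - ι (s R.* h zero) + - ι (s R.* sumᴿ (tail h))
        ≈⟨ -‿+-comm _ _ ⟩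
      - (ι (s R.* h zero) + ι (s R.* sumᴿ (tail h)))
        ≈⟨ -‿cong (ι.+-homo _ _) ⟨
      - ι (s R.* h zero R.+ s R.* sumᴿ (tail h))
        ≈⟨ -‿cong (ι.⟦⟧-cong (R.distribˡ _ _ _)) ⟨
      - ι (s R.* sumᴿ h) ∎

    -- The adjacency matrix is symmetric, so its column sums are the degrees; this is where
    -- regularity makes the sum independent of `f`.
    columnSum : ∀ {r} F → Regular r F → ∀ d f →
      sum (λ g → entry d ⌊ g ≟ f ⌋ (adj F g f)) ≈ (x + - ι d) + - ι (s R.* (r R.· R.1#))
    columnSum {r} F regular d f = trans
      (∑-distrib-+ (λ g → if ⌊ g ≟ f ⌋ then x + - ι d else 0#) (λ g → - ι (s R.* 𝟙 (adj F g f))))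
      (+-cong (sum-diagonal f (x + - ι d)) (trans (sum-weights (λ g → 𝟙 (adj F g f)))
        (-‿cong (ι.⟦⟧-cong (R.*-congˡ (R.trans
          (sumᴿ-cong λ g → R.reflexive (≡.cong 𝟙 (Graph.sym F g f)))
          (R.trans (sum-𝟙 (adj F f)) (R.reflexive (≡.cong (R._· R.1#) (regular f))))))))))

    -- As sign² = 1, y I - sign A(F) is sign ((sign y) I - A(F)), the value of X I - A(F) at sign y.
    det-entry : ∀ F d → det rawRing (λ g f → entry d ⌊ g ≟ f ⌋ (adj F g f)) ≈
      ι s ^ order F * ⟦ ι s * (x + - ι d) ⟧ (charpoly (adjacencyMatrix R.rawRing F))
    det-entry F d = begin
      det rawRing (λ g f → entry d ⌊ g ≟ f ⌋ (adj F g f))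
        ≈⟨ det-cong (λ g f → sym (scaled ⌊ g ≟ f ⌋ (𝟙 (adj F g f)))) ⟩
      det rawRing (λ g f → ι s * ⟦ z ⟧ (polyEntry ⌊ g ≟ f ⌋ (𝟙 (adj F g f))))
        ≈⟨ det-scale (ι s) (λ g f → ⟦ z ⟧ (polyEntry ⌊ g ≟ f ⌋ (𝟙 (adj F g f)))) ⟩
      ι s ^ order F * det rawRing (λ g f → ⟦ z ⟧ (polyEntry ⌊ g ≟ f ⌋ (𝟙 (adj F g f))))
        ≈⟨ *-congˡ (det-homo (Polynomial.polyRing R.rawRing) S (⟦⟧-homo z) (λ g f → polyEntry ⌊ g ≟ f ⌋ (𝟙 (adj F g f)))) ⟨
      ι s ^ order F * ⟦ z ⟧ (charpoly (adjacencyMatrix R.rawRing F)) ∎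
      where
      y = x + - ι d
      z = ι s * y
      polyEntry : Bool → R.Carrier → Poly
      polyEntry b a = if b then Polynomial.X-_ R.rawRing a else (R.- a) ∷ []
      scaled : ∀ b a → ι s * ⟦ z ⟧ (polyEntry b a) ≈ (if b then y else 0#) + - ι (s R.* a)
      scaled true a = begin
        ι s * (ι (R.- a) + z * ⟦ z ⟧ (R.1# ∷ []))
          ≈⟨ *-congˡ (+-congˡ (trans (*-congˡ (trans (⟦⟧-const z R.1#) ι.1#-homo)) (*-identityʳ z))) ⟩
        ι s * (ι (R.- a) + z)
          ≈⟨ trans (distribˡ _ _ _) (+-comm _ _) ⟩
        ι s * (ι s * y) + ι s * ι (R.- a)
          ≈⟨ +-cong (trans (sym (*-assoc _ _ _)) (trans (*-congʳ ι-sign²) (*-identityˡ y))) (weight a) ⟩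
        y + - ι (s R.* a) ∎
        where
        ι-sign² : ι s * ι s ≈ 1#
        ι-sign² = trans (sym (ι.*-homo _ _)) (trans (ι.⟦⟧-cong (sign² X)) ι.1#-homo)
        weight : ∀ a → ι s * ι (R.- a) ≈ - ι (s R.* a)
        weight a = trans (*-congˡ (ι.-‿homo a)) (trans (sym (-‿distribʳ-* _ _)) (-‿cong (sym (ι.*-homo _ _))))
      scaled false a = trans (*-congˡ (⟦⟧-const z (R.- a))) (trans (*-congˡ (ι.-‿homo a))
        (trans (sym (-‿distribʳ-* _ _)) (trans (-‿cong (sym (ι.*-homo _ _))) (sym (+-identityˡ _)))))

    module _ (G : Graph) (N : Fin (order G) → Fin (order G) → Bool) (r : ℕ) where
      private
        n = order G
        Outer = Fin n ⊎ Fin n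
        side : Fin (n ℕ.+ n) → Outer
        side = splitAt n

      -- Equals the order of G plus `r`; it is left as counts so as to agree literally with
      -- `degree-index`.
      fibreDegree : ℕ
      fibreDegree = count {n} (λ _ → true) ℕ.+ r ℕ.+ count {n} (λ _ → false)

      outerDegree : ℕ → Outer → ℕ
      outerDegree m (inj₁ i) = count (adj G i) ℕ.+ count {m} (λ _ → true) ℕ.+ count (λ k → N k i)
      outerDegree m (inj₂ k) = count (N k) ℕ.+ count {m} (λ _ → false) ℕ.+ count {n} (λ _ → false)

      outerEdge : Outer → Outer → Bool
      outerEdge (inj₁ i) (inj₁ j) = adj G i j
      outerEdge (inj₁ i) (inj₂ l) = N l i
      outerEdge (inj₂ k) (inj₁ j) = N k j
      outerEdge (inj₂ k) (inj₂ l) = false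

      border : Outer → Bool
      border = [ const true , const false ]′

      d₀ : R.Carrier
      d₀ = diagonal X fibreDegree

      β : Carrier
      β = (x + - ι d₀) + - ι (s R.* (r R.· R.1#))

      w : Fin (n ℕ.+ n) → Carrier
      -- The summand 0 makes this literally an off-diagonal `entry`.
      w i = 0# + - ι (s R.* 𝟙 (border (side i)))

      -- This is β times the Schur complement of the block on the regular graph. That block has
      -- constant row and column sums β and borders constant along it, so the correction term is m w
      -- i w j divided by β; multiplying by β avoids the inverse. The regular graph survives only
      -- through its order and `r`.
      outerBlock : ℕ → Matrix Carrier (n ℕ.+ n)
      outerBlock m i j =
        β * entry (diagonal X (outerDegree m (side i))) ⌊ i ≟ j ⌋ (outerEdge (side i) (side j))
          + sum {m} (λ g → - w i * w j)

      -- The power of β on the left pays for scaling the rows of all base vertices and copies.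
      det-attach : ∀ F → Regular r F →
        β ^ (n ℕ.+ n) * det rawRing (char (matrix R.rawRing X (attach G F N))) ≈
        (ι s ^ order F * ⟦ ι s * (x + - ι d₀) ⟧ (charpoly (adjacencyMatrix R.rawRing F)))
          * det rawRing (outerBlock (order F))
      det-attach F regular = begin
        β ^ (n ℕ.+ n) * det rawRing M
          ≈⟨ *-congˡ (det-permute reorder M) ⟨
        β ^ (n ℕ.+ n) * det rawRing M′
          ≈⟨ det-bordered m M′ β w outer-fibre (λ f → trans (sum-cong-≋ λ g → fibre-fibre g f) (columnSum F regular d₀ f)) ⟩
        _
          ≈⟨ *-cong (trans (det-cong fibre-fibre) (det-entry F d₀))
               (det-cong λ i j → +-cong (*-congˡ (outer-outer i j)) (sum-cong-≋ λ g → *-congˡ (fibre-outer g j))) ⟩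
        (ι s ^ m * ⟦ ι s * (x + - ι d₀) ⟧ (charpoly (adjacencyMatrix R.rawRing F))) * det rawRing (outerBlock m) ∎
        where
        open Attached G F N
        m = order F
        M : Matrix Carrier (n ℕ.+ m ℕ.+ n)
        M = char (matrix R.rawRing X (attach G F N))
        M′ : Matrix Carrier (m ℕ.+ (n ℕ.+ n))
        M′ i j = M (reorder ⟨$⟩ʳ i) (reorder ⟨$⟩ʳ j)
        ix : Vertex n m → Fin (n ℕ.+ m ℕ.+ n)
        ix = index
        entry-index : ∀ v v′ {d b e} → degree (attach G F N) (ix v) ≡ d → ⌊ ix v ≟ ix v′ ⌋ ≡ b → edge v v′ ≡ e →
          M (ix v) (ix v′) ≈ entry (diagonal X d) b e
        entry-index v v′ ≡.refl ≡.refl ≡.refl = trans (char-entry (attach G F N) (ix v) (ix v′))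
          (reflexive (≡.cong (entry _ _) (adj-index v v′)))
        degree-fibre : ∀ f → degree (attach G F N) (ix (fibre f)) ≡ fibreDegree
        degree-fibre f = ≡.trans (degree-index (fibre f))
          (≡.cong (λ k → count {n} (λ _ → true) ℕ.+ k ℕ.+ count {n} (λ _ → false)) (regular f))
        outer-side : Outer → Vertex n m
        outer-side = [ (λ i → base i) , (λ k → copy k) ]′
        degree-outer : ∀ t → degree (attach G F N) (ix (outer-side t)) ≡ outerDegree m t
        degree-outer (inj₁ i) = degree-index (base i)
        degree-outer (inj₂ k) = degree-index (copy k)
        edge-outer : ∀ t t′ → edge (outer-side t) (outer-side t′) ≡ outerEdge t t′
        edge-outer (inj₁ i) (inj₁ j) = ≡.refl
        edge-outer (inj₁ i) (inj₂ l) = ≡.refl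
        edge-outer (inj₂ k) (inj₁ j) = ≡.refl
        edge-outer (inj₂ k) (inj₂ l) = ≡.refl
        edge-border : ∀ t f → edge (outer-side t) (fibre f) ≡ border t
        edge-border (inj₁ i) f = ≡.refl
        edge-border (inj₂ k) f = ≡.refl
        edge-border′ : ∀ f t → edge (fibre f) (outer-side t) ≡ border t
        edge-border′ f (inj₁ i) = ≡.refl
        edge-border′ f (inj₂ k) = ≡.refl
        outer≢fibre : ∀ t f → outer-side t ≢ fibre f
        outer≢fibre (inj₁ i) f ()
        outer≢fibre (inj₂ k) f ()
        fibre-injective : ∀ {f g : Fin m} → ix (fibre f) ≡ ix (fibre g) → f ≡ g
        fibre-injective e with index-injective {v = fibre _} {fibre _} e
        ... | ≡.refl = ≡.refl
        fibre-fibre : ∀ g f → M′ (g ↑ˡ (n ℕ.+ n)) (f ↑ˡ (n ℕ.+ n)) ≈ entry d₀ ⌊ g ≟ f ⌋ (adj F g f)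
        fibre-fibre g f = trans (reflexive (≡.cong₂ M (reorder-↑ˡ g) (reorder-↑ˡ f)))
          (entry-index (fibre g) (fibre f) (degree-fibre g) (⌊≟⌋-injective (λ f → ix (fibre f)) fibre-injective g f) ≡.refl)
        outer-fibre : ∀ i f → M′ (m ↑ʳ i) (f ↑ˡ (n ℕ.+ n)) ≈ w i
        outer-fibre i f = trans (reflexive (≡.cong₂ M (reorder-↑ʳ i) (reorder-↑ˡ f)))
          (entry-index (outer i) (fibre f) ≡.refl
            (⌊≟⌋-distinct (outer≢fibre (side i) f ∘ index-injective)) (edge-border (side i) f))
        fibre-outer : ∀ g j → M′ (g ↑ˡ (n ℕ.+ n)) (m ↑ʳ j) ≈ w j
        fibre-outer g j = trans (reflexive (≡.cong₂ M (reorder-↑ˡ g) (reorder-↑ʳ j)))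
          (entry-index (fibre g) (outer j) ≡.refl
            (⌊≟⌋-distinct (outer≢fibre (side j) g ∘ ≡.sym ∘ index-injective)) (edge-border′ g (side j)))
        reorder-↑ʳ-injective : ∀ {i j} → ix (outer i) ≡ ix (outer j) → i ≡ j
        reorder-↑ʳ-injective {i} {j} e = ↑ʳ-injective m i j (Injection.injective (↔⇒↣ reorder)
          (≡.trans (reorder-↑ʳ i) (≡.trans e (≡.sym (reorder-↑ʳ j)))))
        outer-outer : ∀ i j → M′ (m ↑ʳ i) (m ↑ʳ j) ≈
          entry (diagonal X (outerDegree m (side i))) ⌊ i ≟ j ⌋ (outerEdge (side i) (side j))
        outer-outer i j = trans (reflexive (≡.cong₂ M (reorder-↑ʳ i) (reorder-↑ʳ j)))
          (entry-index (outer i) (outer j) (degree-outer (side i))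
            (⌊≟⌋-injective (λ i → ix (outer i)) reorder-↑ʳ-injective i j) (edge-outer (side i) (side j)))

      det-attach-cong : ∀ {F H} → Regular r F → Regular r H → order F ≡ order H →
        charpoly (adjacencyMatrix R.rawRing F) ≋ charpoly (adjacencyMatrix R.rawRing H) →
        β ^ (n ℕ.+ n) * det rawRing (char (matrix R.rawRing X (attach G F N))) ≈
        β ^ (n ℕ.+ n) * det rawRing (char (matrix R.rawRing X (attach G H N)))
      det-attach-cong {F} {H} regularF regularH m≡m′ χF≋χH = begin
        _ ≈⟨ det-attach F regularF ⟩
        _ ≈⟨ *-congʳ (*-congˡ (IsRingHomomorphism.⟦⟧-cong (⟦⟧-homo z)
              {charpoly (adjacencyMatrix R.rawRing F)} {charpoly (adjacencyMatrix R.rawRing H)} χF≋χH)) ⟩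
        f (order F) ≈⟨ reflexive (≡.cong f m≡m′) ⟩
        f (order H) ≈⟨ det-attach H regularH ⟨
        _ ∎
        where
        z = ι s * (x + - ι d₀)
        f : ℕ → Carrier
        f m = (ι s ^ m * ⟦ z ⟧ (charpoly (adjacencyMatrix R.rawRing H))) * det rawRing (outerBlock m)

-- Cospectrality of splitting joins

module _ {c ℓ₁ ℓ₂} (K : AlgebraicallyClosedField₀ c ℓ₁ ℓ₂) where
  open AlgebraicallyClosedField₀ K using (commutativeRing)
  open CommutativeRing commutativeRing hiding (zero)
  open PolynomialRing commutativeRing
  open Splitting K using (spectrum-exists; charpoly-monic; monic-degree-unique)

  private
    constant : Carrier → Poly
    constant a = a ∷ []

    constant-homo : IsRingHomomorphism rawRing polyRing constant
    constant-homo = record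
      { isSemiringHomomorphism = record
        { isNearSemiringHomomorphism = record
          { +-isMonoidHomomorphism = record
            { isMagmaHomomorphism = record
              { isRelHomomorphism = record { cong = λ { a≈b zero → a≈b ; a≈b (suc k) → refl } }
              ; homo = λ a b k → refl
              }
            ; ε-homo = λ { zero → refl ; (suc k) → refl }
            }
          ; *-homo = λ { a b zero → sym (+-identityʳ _) ; a b (suc k) → refl }
          }
        ; 1#-homo = λ k → refl
        }
      ; -‿homo = λ a k → refl
      }

    -- The target ring is the polynomial ring and x its indeterminate, so `char M` is the usual
    -- characteristic matrix and β a linear polynomial.
    open CharacteristicMatrix commutativeRing polyCommutativeRing constant-homo (0# ∷ 1# ∷ [])

    charpoly-char : ∀ {n} (M : Matrix Carrier n) → charpoly M ≋ det polyRing (char M)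
    charpoly-char M = Determinant.det-cong polyCommutativeRing λ i j → entry-char ⌊ i ≟ j ⌋ (M i j)
      where
      entry-char : ∀ b a → (if b then X- a else (- a) ∷ []) ≋
        ((if b then 0# ∷ 1# ∷ [] else []) +ᴾ ((- a) ∷ []))
      entry-char true  a zero    = sym (+-identityˡ _)
      entry-char true  a (suc k) = refl
      entry-char false a k       = refl

    lead-β : ∀ X G N r → Lead (β X G N r) 1 1#
    lead-β X G N r = refl , λ { (suc zero) (s≤s ()) ; (suc (suc k)) _ → refl }

    same-spectrum : ∀ {m n} (M : Matrix Carrier m) (N : Matrix Carrier n) → charpoly M ≋ charpoly N →
      ∀ xs → HasSpectrum M xs → HasSpectrum N xs
    same-spectrum M N e xs spectrum k = trans (sym (e k)) (spectrum k)

  attach-cospectral : ∀ {r F H} → Regular r F → Regular r H → Cospectral K A F H →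
    ∀ X G N → Cospectral K X (attach G F N) (attach G H N)
  attach-cospectral {r} {F} {H} regularF regularH (xs , χF , χH) X G N =
    let M = matrix rawRing X (attach G F N)
        M′ = matrix rawRing X (attach G H N)
        -- Cospectrality asks for a list of eigenvalues; the one that exists for the first join will
        -- serve both.
        ys , spectrum = spectrum-exists M
        F≋H = λ k → trans (χF k) (sym (χH k))
        orders = monic-degree-unique {charpoly (adjacencyMatrix rawRing F)} {charpoly (adjacencyMatrix rawRing H)}
          F≋H (charpoly-monic (adjacencyMatrix rawRing F)) (charpoly-monic (adjacencyMatrix rawRing H))
        e = monic-^-cancel (lead-β X G N r)
              (order G ℕ.+ order G) (det polyRing (char M)) (det polyRing (char M′))
              (det-attach-cong X G N r regularF regularH orders F≋H)
        M≋M′ : charpoly M ≋ charpoly M′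
        M≋M′ = λ k → trans (charpoly-char M k) (trans (e k) (sym (charpoly-char M′ k)))
    in ys , spectrum , same-spectrum M M′ M≋M′ ys spectrum

-- Isomorphisms of splitting joins

open ≡ using (refl; sym; trans; cong; cong₂; subst)

all⊎any : ∀ {n p q} {P : Fin n → Set p} {Q : Fin n → Set q} → (∀ i → P i ⊎ Q i) → (∀ i → P i) ⊎ ∃ Q
all⊎any {zero}  P⊎Q = inj₁ λ ()
all⊎any {suc n} P⊎Q with P⊎Q zero | all⊎any (P⊎Q ∘ suc)
... | inj₂ q | _             = inj₂ (zero , q)
... | inj₁ p | inj₁ ps       = inj₁ λ { zero → p ; (suc i) → ps i }
... | inj₁ p | inj₂ (i , q)  = inj₂ (suc i , q)

-- A missed point could be punched out of the codomain, leaving an injection into a smaller set.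
injective⇒surjective : ∀ {m n} → m ≡ n → {f : Fin m → Fin n} → Injective _≡_ _≡_ f → ∀ y → ∃ λ x → f x ≡ y
injective⇒surjective {n = suc n} refl {f} inj y with any? (λ x → f x ≟ y)
... | yes hit = hit
... | no miss = contradiction
  (injective⇒≤ {f = λ x → punchOut (y≢f x)} λ {x} {x′} e → inj (punchOut-injective (y≢f x) (y≢f x′) e)) ℕₚ.1+n≰n
  where
  y≢f : ∀ x → y ≢ f x
  y≢f x y≡fx = miss (x , sym y≡fx)

injection⇒≅ : ∀ {F H} → order F ≡ order H → (f : Fin (order F) → Fin (order H)) → Injective _≡_ _≡_ f →
  (∀ i j → adj H (f i) (f j) ≡ adj F i j) → F ≅ H
injection⇒≅ orders f inj preserves = record
  { bijection = mk↔ₛ′ f (proj₁ ∘ onto) (proj₂ ∘ onto) (λ x → inj (proj₂ (onto (f x))))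
  ; preserves = preserves
  }
  where onto = injective⇒surjective orders inj

count-zero : ∀ {n} (h : Fin n → Bool) → count h ≡ 0 → ∀ i → h i ≡ false
count-zero {suc n} h e i with h zero in h₀
count-zero {suc n} h () i       | true
count-zero {suc n} h e zero    | false = h₀
count-zero {suc n} h e (suc i) | false = count-zero (h ∘ suc) e i

count-none : ∀ {n} (h : Fin n → Bool) → (∀ i → h i ≡ false) → count h ≡ 0
count-none {zero}  h none = refl
count-none {suc n} h none rewrite none zero = count-none (h ∘ suc) (none ∘ suc)

-- Deleting one false position from each function preserves the counts; the first then attains the
-- maximal count, hence so does the second, which must be true everywhere else.
count-full-off : ∀ {n} (h h′ : Fin n → Bool) i i′ → h′ i′ ≡ false → (∀ j → j ≢ i → h j ≡ true) → h i ≡ false →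
  count h ≡ count h′ → ∀ j → j ≢ i′ → h′ j ≡ true
count-full-off {suc n} h h′ i i′ h′i′ full hi e j j≢i′ = subst (λ x → h′ x ≡ true) (punchIn-punchOut (j≢i′ ∘ sym))
  (count-all (h′ ∘ punchIn i′) (trans (sym (count-remove h′ i′ h′i′)) (trans (sym e)
    (trans (count-remove h i hi) (all-count (h ∘ punchIn i) λ k → full (punchIn i k) (punchInᵢ≢i i k))))) _)
  where
  all-count : ∀ {n} (h : Fin n → Bool) → (∀ i → h i ≡ true) → count h ≡ n
  all-count {zero}  h all = refl
  all-count {suc n} h all rewrite all zero = cong suc (all-count (h ∘ suc) (all ∘ suc))
  count≤ : ∀ {n} (h : Fin n → Bool) → count h ℕ.≤ n
  count≤ {zero}  h = ℕ.z≤n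
  count≤ {suc n} h with h zero
  ... | true  = ℕ.s≤s (count≤ (h ∘ suc))
  ... | false = ℕₚ.m≤n⇒m≤1+n (count≤ (h ∘ suc))
  count-all : ∀ {n} (h : Fin n → Bool) → count h ≡ n → ∀ i → h i ≡ true
  count-all {suc n} h e i with h zero in h₀
  count-all {suc n} h e zero    | true  = h₀
  count-all {suc n} h e (suc i) | true  = count-all (h ∘ suc) (ℕₚ.suc-injective e) i
  count-all {suc n} h e i       | false = contradiction (subst (ℕ._≤ _) e (count≤ (h ∘ suc))) ℕₚ.1+n≰n
  count-remove : ∀ {n} (h : Fin (suc n) → Bool) i → h i ≡ false → count h ≡ count (h ∘ punchIn i)
  count-remove h zero hi rewrite hi = refl
  count-remove {suc n} h (suc i) hi with h zero
  ... | true  = cong suc (count-remove (h ∘ suc) i hi)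
  ... | false = count-remove (h ∘ suc) i hi

constant-off-diagonal⇒≅ : ∀ {F H} b → order F ≡ order H → (∀ i j → i ≢ j → adj F i j ≡ b) →
  (∀ i j → i ≢ j → adj H i j ≡ b) → F ≅ H
constant-off-diagonal⇒≅ {F} {H} b orders Fb Hb = injection⇒≅ orders to to-injective preserves
  where
  to : Fin (order F) → Fin (order H)
  to = subst Fin orders
  to-injective : Injective _≡_ _≡_ to
  to-injective = subst-injective orders
    where
    subst-injective : ∀ {m n} (e : m ≡ n) → Injective _≡_ _≡_ (subst Fin e)
    subst-injective refl = id
  preserves : ∀ i j → adj H (to i) (to j) ≡ adj F i j
  preserves i j with i ≟ j
  ... | yes refl = trans (Graph.irrefl H _) (sym (Graph.irrefl F i))
  ... | no i≢j   = trans (Hb _ _ (i≢j ∘ to-injective)) (sym (Fb i j i≢j))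

Complete : Graph → Set
Complete F = ∀ i j → i ≢ j → adj F i j ≡ true

dominating⇒complete : ∀ {r F} → Regular r F → ∀ i → (∀ j → j ≢ i → adj F i j ≡ true) → Complete F
dominating⇒complete {F = F} regular i dominating k j k≢j =
  count-full-off (adj F i) (adj F k) i k (Graph.irrefl F k) dominating (Graph.irrefl F i)
    (trans (regular i) (sym (regular k))) j (k≢j ∘ sym)

-- An isomorphism of joins read on the sum type, where the three kinds of vertices are told apart by
-- pattern matching. The inverse is part of the data, so that F and H can be interchanged.
record Match (G F H : Graph) (N : Fin (order G) → Fin (order G) → Bool) : Set where
  field
    to      : Vertex (order G) (order F) → Vertex (order G) (order H)
    from    : Vertex (order G) (order H) → Vertex (order G) (order F)
    to-from : ∀ v → to (from v) ≡ v
    from-to : ∀ v → from (to v) ≡ v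
    to-edge : ∀ v w → Attached.edge G H N (to v) (to w) ≡ Attached.edge G F N v w

≅⇒Match : ∀ G F H N → attach G F N ≅ attach G H N → Match G F H N
≅⇒Match G F H N iso = record
  { to      = to
  ; from    = λ v → vertex (Inverse.from bijection (index v))
  ; to-from = λ v → trans (cong (vertex ∘ Inverse.to bijection) (index-vertex {order G} {order F} _))
                (trans (cong vertex (Inverse.strictlyInverseˡ bijection (index v))) (vertex-index v))
  ; from-to = λ v → trans (cong (vertex ∘ Inverse.from bijection) (index-vertex {order G} {order H} _))
                (trans (cong vertex (Inverse.strictlyInverseʳ bijection (index v))) (vertex-index v))
  ; to-edge = λ v w → trans (sym (Attached.adj-index G H N (to v) (to w)))
                (trans (cong₂ (adj (attach G H N)) (index-vertex {order G} {order H} _) (index-vertex {order G} {order H} _))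
                (trans (preserves (index v) (index w)) (Attached.adj-index G F N v w)))
  }
  where
  open _≅_ iso
  to : Vertex (order G) (order F) → Vertex (order G) (order H)
  to v = vertex (Inverse.to bijection (index v))

Match-flip : ∀ {G F H N} → Match G F H N → Match G H F N
Match-flip {G} {F} {H} {N} M = record
  { to = from ; from = to ; to-from = from-to ; from-to = to-from
  ; to-edge = λ v w → trans (sym (to-edge (from v) (from w)))
      (cong₂ (Attached.edge G H N) (to-from v) (to-from w))
  }
  where open Match M

attach-order : ∀ G F H N → attach G F N ≅ attach G H N → order F ≡ order H
attach-order G F H N iso = ℕₚ.+-cancelˡ-≡ (order G) (order F) (order H)
  (ℕₚ.+-cancelʳ-≡ (order G) (order G ℕ.+ order F) (order G ℕ.+ order H) (↔⇒≡ (_≅_.bijection iso)))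

module Matching {G F H N} (M : Match G F H N) where
  open Match M
  private
    n = order G
    E : ∀ F → (v w : Vertex n (order F)) → Bool
    E F = Attached.edge G F N

  transport : ∀ {v w v′ w′} → to v ≡ v′ → to w ≡ w′ → E F v w ≡ E H v′ w′
  transport {v} {w} p q = trans (sym (to-edge v w)) (cong₂ (E H) p q)

  to-injective : ∀ {v w} → to v ≡ to w → v ≡ w
  to-injective {v} {w} p = trans (sym (from-to v)) (trans (cong from p) (from-to w))

  to-flip : ∀ {v v′} → from v′ ≡ v → to v ≡ v′
  to-flip p = trans (cong to (sym p)) (to-from _)

  Stray : Vertex n (order H) → Set
  Stray v = (∃ λ i → v ≡ base i) ⊎ (∃ λ k → v ≡ copy k)

  fibre⊎stray : ∀ v → (∃ λ f → v ≡ fibre f) ⊎ Stray v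
  fibre⊎stray (base i)  = inj₂ (inj₁ (i , refl))
  fibre⊎stray (fibre f) = inj₁ (f , refl)
  fibre⊎stray (copy k)  = inj₂ (inj₂ (k , refl))

  -- Here and in the next lemma: a fibre and a base vertex are always joined, a fibre vertex and a
  -- copy never, so an edge-preserving map cannot turn a pair of one sort into a pair of the other.
  no-fibre-to-copy : ∀ {a i j h} → to (fibre a) ≡ copy i → to (base j) ≢ fibre h
  no-fibre-to-copy p q with transport p q
  ... | ()

  no-copy-to-fibre : ∀ {a i k h} → to (fibre a) ≡ base i → to (copy k) ≢ fibre h
  no-copy-to-fibre p q with transport p q
  ... | ()

  -- The preimage of `h′` is not a base vertex: those are joined to `a`, but the image of `a` is a
  -- copy and has no neighbour in H. So it is a fibre vertex or a copy, and neither kind is joined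
  -- to the copy `k` sent to `h`.
  copies⇒isolated : ∀ {a i k h} → to (fibre a) ≡ copy i → to (copy k) ≡ fibre h → ∀ h′ → adj H h h′ ≡ false
  copies⇒isolated {a} {i} {k} {h} p q h′ with from (fibre h′) in e
  ... | base j  with transport p (to-flip e)
  ...   | ()
  copies⇒isolated p q h′ | fibre f = sym (transport q (to-flip e))
  copies⇒isolated p q h′ | copy l  = sym (transport q (to-flip e))

  -- Every other way of displacing a vertex of F or H is impossible or isolates a vertex of H.
  record Exchange : Set where
    field
      a₀         : Fin (order F)
      i₀         : Fin n
      a₀↦        : to (fibre a₀) ≡ base i₀
      h₀         : Fin (order H)
      j₀         : Fin n
      ↦h₀        : to (base j₀) ≡ fibre h₀
      from-fibre : ∀ h → (∃ λ a → to (fibre a) ≡ fibre h) ⊎ (∃ λ j → to (base j) ≡ fibre h)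
      to-fibre   : ∀ a → (∃ λ h → to (fibre a) ≡ fibre h) ⊎ (∃ λ i → to (fibre a) ≡ base i)

fibres⇒≅ : ∀ {G F H N} (M : Match G F H N) → order F ≡ order H →
  (∀ a → ∃ λ h → Match.to M (fibre a) ≡ fibre h) → F ≅ H
fibres⇒≅ {G} {F} {H} {N} M orders fibres = injection⇒≅ orders (proj₁ ∘ fibres) injective
  (λ a b → sym (transport (proj₂ (fibres a)) (proj₂ (fibres b))))
  where
  open Matching M
  injective : Injective _≡_ _≡_ (proj₁ ∘ fibres)
  injective {a} {b} e with to-injective (trans (proj₂ (fibres a))
    (trans (cong (λ h → fibre h) e) (sym (proj₂ (fibres b)))))
  ... | refl = refl

regular-isolated : ∀ {r F} → Regular r F → ∀ i → (∀ j → adj F i j ≡ false) → r ≡ 0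
regular-isolated {F = F} regular i isolated = trans (sym (regular i)) (count-none (adj F i) isolated)

regular-zero⇒≅ : ∀ {F H} → Regular 0 F → Regular 0 H → order F ≡ order H → F ≅ H
regular-zero⇒≅ {F} {H} regularF regularH orders = constant-off-diagonal⇒≅ false orders
  (λ i j _ → count-zero (adj F i) (regularF i) j) (λ i j _ → count-zero (adj H i) (regularH i) j)

≅-sym : ∀ {F H} → F ≅ H → H ≅ F
≅-sym {F} {H} iso = record
  { bijection = ↔-sym bijection
  ; preserves = λ i j → trans (sym (preserves _ _))
      (cong₂ (adj H) (Inverse.strictlyInverseˡ bijection i) (Inverse.strictlyInverseˡ bijection j))
  }
  where open _≅_ iso

-- If F is sent into H, or H back into F, equal orders give an isomorphism. Otherwise a vertex of F
-- leaves and a vertex of H enters from outside. Copies on both sides isolate a vertex of H, a copy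
-- on one side and a base vertex on the other contradict each other, and base vertices on both sides
-- form an exchange.
≅⊎exchange : ∀ {G F H N r} → Regular r H → r ≢ 0 → order F ≡ order H →
  (M : Match G F H N) → (F ≅ H) ⊎ Matching.Exchange M
≅⊎exchange {G} {F} {H} {N} regular r≢0 orders M
  with all⊎any (λ a → Matching.fibre⊎stray M (Match.to M (fibre a)))
     | all⊎any (λ h → Matching.fibre⊎stray (Match-flip M) (Match.from M (fibre h)))
... | inj₁ fibres | _ = inj₁ (fibres⇒≅ M orders fibres)
... | _ | inj₁ fibres = inj₁ (≅-sym (fibres⇒≅ (Match-flip M) (sym orders) fibres))
... | inj₂ (a₀ , inj₂ (i , a₀↦)) | inj₂ (h₀ , inj₂ (k , h₀↦)) =
  contradiction (regular-isolated {F = H} regular h₀ (copies⇒isolated a₀↦ (to-flip h₀↦))) r≢0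
  where open Matching M
... | inj₂ (a₀ , inj₂ (i , a₀↦)) | inj₂ (h₀ , inj₁ (j , h₀↦)) =
  contradiction (to-flip h₀↦) (no-fibre-to-copy a₀↦)
  where open Matching M
... | inj₂ (a₀ , inj₁ (i , a₀↦)) | inj₂ (h₀ , inj₂ (k , h₀↦)) =
  contradiction (to-flip h₀↦) (no-copy-to-fibre a₀↦)
  where open Matching M
... | inj₂ (a₀ , inj₁ (i₀ , a₀↦)) | inj₂ (h₀ , inj₁ (j₀ , h₀↦)) = inj₂ record
  { a₀ = a₀ ; i₀ = i₀ ; a₀↦ = a₀↦ ; h₀ = h₀ ; j₀ = j₀ ; ↦h₀ = to-flip h₀↦
  ; from-fibre = from-fibre ; to-fibre = to-fibre }
  where
  open Match M
  open Matching M
  -- The single displaced vertex `a₀` excludes copies as preimages for all vertices of H at once;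
  -- `h₀` does the same for images of F.
  from-fibre : ∀ h → (∃ λ a → to (fibre a) ≡ fibre h) ⊎ (∃ λ j → to (base j) ≡ fibre h)
  from-fibre h with from (fibre h) in e
  ... | fibre a = inj₁ (a , to-flip e)
  ... | base j  = inj₂ (j , to-flip e)
  ... | copy k  = contradiction (to-flip e) (no-copy-to-fibre a₀↦)
  to-fibre : ∀ a → (∃ λ h → to (fibre a) ≡ fibre h) ⊎ (∃ λ i → to (fibre a) ≡ base i)
  to-fibre a with to (fibre a) in e
  ... | fibre h = inj₁ (h , refl)
  ... | base i  = inj₂ (i , refl)
  ... | copy k  = contradiction (to-flip h₀↦) (no-fibre-to-copy e)

Exchange-flip : ∀ {G F H N} {M : Match G F H N} → Matching.Exchange M → Matching.Exchange (Match-flip M)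
Exchange-flip {M = M} X = record
  { a₀ = h₀ ; i₀ = j₀ ; a₀↦ = back ↦h₀ ; h₀ = a₀ ; j₀ = i₀ ; ↦h₀ = back a₀↦
  ; from-fibre = λ a → Sum.map (λ (h , e) → h , back e) (λ (i , e) → i , back e) (to-fibre a)
  ; to-fibre = λ h → Sum.map (λ (a , e) → a , back e) (λ (j , e) → j , back e) (from-fibre h)
  }
  where
  open Match M
  open Matching.Exchange X
  back : ∀ {v v′} → to v ≡ v′ → from v′ ≡ v
  back {v} e = trans (cong from (sym e)) (from-to v)

module Exchanging {G F H N} {M : Match G F H N} (N-irrefl : ∀ i → N i i ≡ false)
  (X : Matching.Exchange M) where
  open Match M
  open Matching M
  open Exchange X

  -- The copy of a base vertex sent into H is not adjacent to it, so it is sent to a copy,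
  -- and copies are not adjacent to H.
  exchanged-nonadjacent : ∀ {j h j′ h′} → to (base j) ≡ fibre h → to (base j′) ≡ fibre h′ → N j j′ ≡ false
  exchanged-nonadjacent {j} {h} {j′} {h′} j↦h j′↦h′ with to (copy j) in e
  ... | base i  = contradiction (trans (sym (N-irrefl j)) (transport e j↦h)) λ ()
  ... | copy k  = transport e j′↦h′
  ... | fibre f = contradiction e (no-copy-to-fibre a₀↦)

  -- The vertex `h₀` comes from a base vertex, hence is joined to everything that comes from F. The
  -- other vertices of H come from base vertices that `N` does not relate to it, and `co` makes
  -- these adjacent in G. So `h₀` dominates H, and regularity spreads this to all vertices.
  exchange⇒complete : ∀ {r} → Regular r H →
    (∀ j j′ → j ≢ j′ → N j j′ ≡ false → adj G j j′ ≡ true) → Complete H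
  exchange⇒complete regular co = dominating⇒complete {F = H} regular h₀ λ h h≢h₀ →
    joined h h≢h₀ (from-fibre h)
    where
    joined : ∀ h → h ≢ h₀ → (∃ λ a → to (fibre a) ≡ fibre h) ⊎ (∃ λ j → to (base j) ≡ fibre h) →
      adj H h₀ h ≡ true
    joined h h≢h₀ (inj₁ (a , e)) = sym (transport ↦h₀ e)
    joined h h≢h₀ (inj₂ (j , e)) = trans (sym (transport ↦h₀ e))
      (co j₀ j (λ { refl → h≢h₀ (fibre-injective (trans (sym e) ↦h₀)) }) (exchanged-nonadjacent ↦h₀ e))
      where
      fibre-injective : ∀ {m n} {f g : Fin m} → _≡_ {A = Vertex n m} (fibre f) (fibre g) → f ≡ g
      fibre-injective refl = refl

module _ {G F H} {M : Match G F H (adj G)} (X : Matching.Exchange M) where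
  open Match M
  open Matching M
  open Exchange X
  open Exchanging (Graph.irrefl G) X

  -- If nothing in H comes from F, all of H comes from base vertices. These are pairwise
  -- non-adjacent, since here `N` is adjacency in G itself.
  shared⊎isolated : (∃₂ λ c b → to (fibre c) ≡ fibre b) ⊎ (∀ h → adj H h₀ h ≡ false)
  shared⊎isolated with all⊎any (λ h → Sum.swap (from-fibre h))
  ... | inj₂ (b , c , e) = inj₁ (c , b , e)
  ... | inj₁ strays      = inj₂ λ h →
    trans (sym (transport ↦h₀ (proj₂ (strays h)))) (exchanged-nonadjacent ↦h₀ (proj₂ (strays h)))

  module _ {c b} (c↦b : to (fibre c) ≡ fibre b) where

    base-to-fibre : ∀ j → ∃ λ h → to (base j) ≡ fibre h
    base-to-fibre j with to (base j) in e
    ... | fibre h = h , refl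
    ... | copy k  = contradiction (transport e c↦b) λ ()
    -- The copy of `p` can only come from a copy, hence has no edge to the image `i₀` of `a₀`. But
    -- `p` has one, since `base j` is joined to `a₀`, and in the NS join `p` and its copy have the
    -- same neighbours in G.
    ... | base p with from (copy p) in e′
    ...   | base i  = contradiction (transport (to-flip e′) c↦b) λ ()
    ...   | fibre f = contradiction ↦h₀ (no-fibre-to-copy (to-flip e′))
    ...   | copy k  = contradiction (trans (transport (to-flip e′) a₀↦) (sym (transport e a₀↦))) λ ()

    -- A vertex of F that is sent to a base vertex is followed one step further.
    data _⇝_ (a : Fin (order F)) (h : Fin (order H)) : Set where
      direct : to (fibre a) ≡ fibre h → a ⇝ h
      via    : ∀ {i} → to (fibre a) ≡ base i → to (base i) ≡ fibre h → a ⇝ h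

    target : ∀ a → ∃ (a ⇝_)
    target a with to-fibre a
    ... | inj₁ (h , e) = h , direct e
    ... | inj₂ (i , e) = let h , e′ = base-to-fibre i in h , via e e′

    ⇝-injective : ∀ {a a′ h} → a ⇝ h → a′ ⇝ h → a ≡ a′
    ⇝-injective (direct e) (direct e′) with to-injective (trans e (sym e′))
    ... | refl = refl
    ⇝-injective (direct e) (via _ e′) with to-injective (trans e (sym e′))
    ... | ()
    ⇝-injective (via _ e) (direct e′) with to-injective (trans e (sym e′))
    ... | ()
    ⇝-injective (via d e) (via d′ e′) with to-injective (trans e (sym e′))
    ... | refl with to-injective (trans d (sym d′))
    ...   | refl = refl

    -- A direct and a displaced vertex are adjacent on both sides, as fibre and base vertices always
    -- are. For two displaced vertices both adjacencies equal that of the base vertices passed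
    -- through, read once as images and once as arguments of the map.
    ⇝-preserves : ∀ {a a′ h h′} → a ⇝ h → a′ ⇝ h′ → adj H h h′ ≡ adj F a a′
    ⇝-preserves (direct e) (direct e′)  = sym (transport e e′)
    ⇝-preserves (direct e) (via d′ e′)  = trans (sym (transport e e′)) (sym (transport e d′))
    ⇝-preserves (via d e)  (direct e′)  = trans (sym (transport e e′)) (sym (transport d e′))
    ⇝-preserves (via d e)  (via d′ e′)  = trans (sym (transport e e′)) (sym (transport d d′))

    shared⇒≅ : order F ≡ order H → F ≅ H
    shared⇒≅ orders = injection⇒≅ orders (proj₁ ∘ target)
      (λ {a} {a′} e → ⇝-injective (proj₂ (target a)) (subst (a′ ⇝_) (sym e) (proj₂ (target a′))))
      (λ a a′ → ⇝-preserves (proj₂ (target a)) (proj₂ (target a′)))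

attach-reflects-≅ : ∀ {r} G F H N → Regular r F → Regular r H →
  (r ≢ 0 → order F ≡ order H → {M : Match G F H N} → Matching.Exchange M → F ≅ H) →
  attach G F N ≅ attach G H N → F ≅ H
attach-reflects-≅ {zero} G F H N regularF regularH exchange iso =
  regular-zero⇒≅ regularF regularH (attach-order G F H N iso)
attach-reflects-≅ {suc r} G F H N regularF regularH exchange iso =
  [ id , exchange (λ ()) orders ]′ (≅⊎exchange regularH (λ ()) orders (≅⇒Match G F H N iso))
  where orders = attach-order G F H N iso

⊻-reflects-≅ : ∀ {r} G F H → Regular r F → Regular r H → (G ⊻ F) ≅ (G ⊻ H) → F ≅ H
⊻-reflects-≅ G F H regularF regularH = attach-reflects-≅ G F H (adj G) regularF regularH λ r≢0 orders X →
  [ (λ (_ , _ , shared) → shared⇒≅ X shared orders)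
  , (λ isolated → contradiction (regular-isolated {F = H} regularH _ isolated) r≢0) ]′ (shared⊎isolated X)

⩣-reflects-≅ : ∀ {r} G F H → Regular r F → Regular r H → (G ⩣ F) ≅ (G ⩣ H) → F ≅ H
⩣-reflects-≅ G F H regularF regularH = attach-reflects-≅ G F H coadj regularF regularH λ _ orders X →
  constant-off-diagonal⇒≅ true orders
    -- An exchange is symmetric in the two graphs, so the argument that completes H, with the sides
    -- interchanged, completes F.
    (Exchanging.exchange⇒complete coadj-irrefl (Exchange-flip X) regularF coadj-false)
    (Exchanging.exchange⇒complete coadj-irrefl X regularH coadj-false)
  where
  coadj : (i j : Fin (order G)) → Bool
  coadj i j = not ⌊ i ≟ j ⌋ ∧ not (adj G i j)
  coadj-irrefl : ∀ i → coadj i i ≡ false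
  coadj-irrefl i with i ≟ i
  ... | yes _  = refl
  ... | no i≢i = contradiction refl i≢i
  coadj-false : ∀ i j → i ≢ j → coadj i j ≡ false → adj G i j ≡ true
  coadj-false i j i≢j e with i ≟ j
  ... | yes i≡j = contradiction i≡j i≢j
  ... | no _    = not-injective e

corollary4p4 : ∀ {c ℓ₁ ℓ₂} (K : AlgebraicallyClosedField₀ c ℓ₁ ℓ₂)
    (r : ℕ) (F H : Graph) →
    Regular r F → Regular r H → ¬ (F ≅ H) → Cospectral K A F H →
    (G : Graph) →
    NICS K (A ∷ Q ∷ L ∷ []) (G ⊻ F) (G ⊻ H) ×
    NICS K (A ∷ Q ∷ L ∷ []) (G ⩣ F) (G ⩣ H)
corollary4p4 K r F H regularF regularH F≇H cospectral G =
  ( F≇H ∘ ⊻-reflects-≅ G F H regularF regularH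
  , λ X _ → attach-cospectral K {F = F} {H} regularF regularH cospectral X G (adj G)) ,
  ( F≇H ∘ ⩣-reflects-≅ G F H regularF regularH
  , λ X _ → attach-cospectral K {F = F} {H} regularF regularH cospectral X G
      (λ i j → not ⌊ i ≟ j ⌋ ∧ not (adj G i j)))
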